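{- Let $P$ be a connected infinite $\Gamma$-colored poset. Then $P$ is a $\Gamma$-colored $d$-complete poset if and only if it is a filter of some connected full heap.
   Context: Setup. $\Gamma$ is a finite set, whose elements are called colors, with fixed integers $\theta_{ab}$ ($a,b\in\Gamma$) such that $\theta_{aa}=2$; $\theta_{ab}\le 0$ for $a\ne b$; and $\theta_{ab}=0$ iff $\theta_{ba}=0$ (a Dynkin diagram). Distinct $a,b$ are adjacent ($a\sim b$) if $\theta_{ab}<0$. All posets are locally finite (all intervals are finite). $x,y$ are neighbors if one covers the other. A $\Gamma$-colored poset is a locally finite poset $P$ with a surjective map $\kappa:P\to\Gamma$; $P_a:=\kappa^{ -1}(a)$. Elements $x<y$ are consecutive elements of the color $a$ if $x,y\in P_a$ and the open interval $(x,y)$ contains no element of color $a$. $U(x,P):=\{y\in P : y>x,\ \kappa(y)\sim\kappa(x)\}$. A poset is connected if it is not the disjoint union (with no relations between the parts) of two or more nonempty subposets. A $\Gamma$-colored poset is $\Gamma$-colored $d$-complete if: (EC) elements with equal colors are comparable; (NA) neighbors have adjacent colors; (AC) elements with adjacent colors are comparable; (ICE2) for every $a\in\Gamma$, if $x<y$ are consecutive elements of the color $a$, then $\sum_{z\in(x,y)}-\theta_{\kappa(z),a}=2$; (UCB1) for every $a\in\Gamma$, if $x$ is maximal in $P_a$, then $U(x,P)$ is finite and $\sum_{y\in U(x,P)}-\theta_{\kappa(y),a}\le 1$. A full heap is a locally finite $\Gamma$-colored poset such that: (G1) for every $a\in\Gamma$ and every pair of adjacent colors $b,c$, the subsets $P_a$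 and $P_b\cup P_c$ are chains; (G2) the partial order on $P$ is the minimal partial order extending the given order on these chains; (G3) for every $a$, $P_a$ is isomorphic as a poset to $\mathbb{Z}$; (G4) if $a\sim b$ and $x\in P_a$, then $x$ has a neighbor in $P_b$; (G5) for every $a$, if $x<y$ are consecutive elements of the color $a$, then $\sum_{z\in[x,y]}\theta_{\kappa(z),a}=2$. "$P$ is a filter of a full heap $Q$" means that $Q$ is a full heap colored by the same Dynkin diagram $\Gamma$, $P$ is an up-closed subset of $Q$, and the order and coloring of $P$ are the restrictions of those of $Q$. -}

module Defs where

open import Level using (Level; _⊔_; suc)
open import Data.Nat.Base using (ℕ)
open import Data.Fin.Base using (Fin)
open import Data.Integer.Base using (ℤ; 0ℤ; 1ℤ; -_; +_; _+_; _≤_; _<_)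
open import Data.List.Base using (List; map; foldr)
import Data.List.Membership.Setoid as Membership
import Data.List.Relation.Unary.Unique.Setoid as UniqueSetoid
open import Data.Product.Base using (Σ; ∃; ∃-syntax; _×_; proj₁)
open import Data.Sum.Base using (_⊎_)
open import Function.Base using (_on_)
open import Function.Bundles using (Surjection; _⇔_)
open import Relation.Binary.Bundles using (Poset)
open import Relation.Binary.Core using (Rel)
open import Relation.Binary.Structures using (IsPartialOrder)
open import Relation.Binary.Morphism.Structures
  using (IsOrderMonomorphism; IsOrderIsomorphism)
import Relation.Binary.Properties.Poset as PosetProperties
open import Relation.Binary.PropositionalEquality.Core using (_≡_; _≢_)
open import Relation.Binary.PropositionalEquality.Properties using (setoid)
open import Relation.Nullary.Negation.Core using (¬_)
open import Relation.Unary using (Pred; _∈_; _∪_; Satisfiable; U)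

record DynkinDiagram : Set where
  field
    size     : ℕ
    θ        : Fin size → Fin size → ℤ
    θ-diag   : ∀ a → θ a a ≡ + 2
    θ-off    : ∀ {a b} → a ≢ b → θ a b ≤ 0ℤ
    θ-zero   : ∀ {a b} → θ a b ≡ 0ℤ ⇔ θ b a ≡ 0ℤ

  Color : Set
  Color = Fin size

  infix 4 _∼_
  _∼_ : Color → Color → Set
  a ∼ b = a ≢ b × θ a b < 0ℤ

module PosetNotions {c ℓ₁ ℓ₂ : Level} (P : Poset c ℓ₁ ℓ₂) where
  open Poset P using (Carrier; _≈_) renaming (_≤_ to _≤ᴾ_)
  open PosetProperties P using () renaming (_<_ to _<ᴾ_)
  open Membership (Poset.Eq.setoid P) using () renaming (_∈_ to _∈ˡ_)
  open UniqueSetoid (Poset.Eq.setoid P) using (Unique)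

  -- The list has no repetitions up to _≈_, so that sums over it count every
  -- element of A exactly once.
  Enumerates : ∀ {ℓ} → List Carrier → Pred Carrier ℓ → Set (c ⊔ ℓ₁ ⊔ ℓ)
  Enumerates xs A = Unique xs × (∀ z → z ∈ˡ xs ⇔ z ∈ A)

  FiniteSubset : ∀ {ℓ} → Pred Carrier ℓ → Set (c ⊔ ℓ₁ ⊔ ℓ)
  FiniteSubset A = ∃[ xs ] Enumerates xs A

  -- "A is finite and the sum of f over A equals s".
  HasSum : ∀ {ℓ} → Pred Carrier ℓ → (Carrier → ℤ) → ℤ → Set (c ⊔ ℓ₁ ⊔ ℓ)
  HasSum A f s = ∃[ xs ] Enumerates xs A × foldr _+_ 0ℤ (map f xs) ≡ s

  [_,_] : Carrier → Carrier → Pred Carrier ℓ₂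
  [ x , y ] z = x ≤ᴾ z × z ≤ᴾ y

  ⦅_,_⦆ : Carrier → Carrier → Pred Carrier (ℓ₁ ⊔ ℓ₂)
  ⦅ x , y ⦆ z = x <ᴾ z × z <ᴾ y

  LocallyFinite : Set (c ⊔ ℓ₁ ⊔ ℓ₂)
  LocallyFinite = ∀ x y → FiniteSubset [ x , y ]

  Infinite : Set (c ⊔ ℓ₁)
  Infinite = ¬ FiniteSubset U

  Comparable : Rel Carrier ℓ₂
  Comparable x y = x ≤ᴾ y ⊎ y ≤ᴾ x

  IsChain : ∀ {ℓ} → Pred Carrier ℓ → Set (c ⊔ ℓ₂ ⊔ ℓ)
  IsChain A = ∀ {x y} → x ∈ A → y ∈ A → Comparable x y

  -- A splitting into more than two parts yields one into two by merging parts.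
  -- Disjointness of B and C, and their invariance under _≈_, follow from
  -- the last clause, as _≤ᴾ_ is reflexive.
  Connected : Set (suc (c ⊔ ℓ₁ ⊔ ℓ₂))
  Connected = ¬ (Σ (Pred Carrier (c ⊔ ℓ₁ ⊔ ℓ₂)) λ B →
                 Σ (Pred Carrier (c ⊔ ℓ₁ ⊔ ℓ₂)) λ C →
                   Satisfiable B × Satisfiable C
                 × (∀ x → x ∈ B ⊎ x ∈ C)
                 × (∀ {x y} → x ∈ B → y ∈ C → ¬ Comparable x y))

  infix 4 _⋖_
  _⋖_ : Rel Carrier (c ⊔ ℓ₁ ⊔ ℓ₂)
  x ⋖ y = x <ᴾ y × ¬ Satisfiable ⦅ x , y ⦆

  Neighbors : Rel Carrier (c ⊔ ℓ₁ ⊔ ℓ₂)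
  Neighbors x y = x ⋖ y ⊎ y ⋖ x

  ExtendsOrderOn : ∀ {ℓ r} → Pred Carrier ℓ → Rel Carrier r → Set (c ⊔ ℓ₂ ⊔ ℓ ⊔ r)
  ExtendsOrderOn A _≼_ = ∀ {x y} → x ∈ A → y ∈ A → x ≤ᴾ y → x ≼ y

record ColoredPoset (Γ : DynkinDiagram) (c ℓ₁ ℓ₂ : Level) : Set (suc (c ⊔ ℓ₁ ⊔ ℓ₂)) where
  open DynkinDiagram Γ using (Color; _∼_)
  field
    poset : Poset c ℓ₁ ℓ₂

  open PosetNotions poset public

  field
    locallyFinite : LocallyFinite
    coloring      : Surjection (Poset.Eq.setoid poset) (setoid Color)

  open Poset poset public using (Carrier; _≈_) renaming (_≤_ to _≤ᴾ_)
  open PosetProperties poset public using () renaming (_<_ to _<ᴾ_)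
  open Surjection coloring public using () renaming (to to κ)

  OfColor : Color → Pred Carrier _
  OfColor a x = κ x ≡ a

  Consecutive : Color → Rel Carrier (c ⊔ ℓ₁ ⊔ ℓ₂)
  Consecutive a x y =
    x <ᴾ y × x ∈ OfColor a × y ∈ OfColor a × (∀ z → z ∈ ⦅ x , y ⦆ → κ z ≢ a)

  MaximalOfColor : Color → Pred Carrier (c ⊔ ℓ₁ ⊔ ℓ₂)
  MaximalOfColor a x = x ∈ OfColor a × (∀ y → y ∈ OfColor a → ¬ x <ᴾ y)

  UpperAdjacent : Carrier → Pred Carrier (ℓ₁ ⊔ ℓ₂)
  UpperAdjacent x y = x <ᴾ y × κ y ∼ κ x

module _ {Γ : DynkinDiagram} {c ℓ₁ ℓ₂ : Level} where
  open DynkinDiagram Γ using (Color; θ; _∼_)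

  record IsDComplete (P : ColoredPoset Γ c ℓ₁ ℓ₂) : Set (c ⊔ ℓ₁ ⊔ ℓ₂) where
    open ColoredPoset P
    field
      EC   : ∀ x y → κ x ≡ κ y → Comparable x y
      NA   : ∀ x y → Neighbors x y → κ x ∼ κ y
      AC   : ∀ x y → κ x ∼ κ y → Comparable x y
      ICE2 : ∀ a x y → Consecutive a x y →
             HasSum ⦅ x , y ⦆ (λ z → - θ (κ z) a) (+ 2)
      UCB1 : ∀ a x → MaximalOfColor a x →
             ∃[ s ] HasSum (UpperAdjacent x) (λ y → - θ (κ y) a) s × s ≤ 1ℤ

  record IsFullHeap (Q : ColoredPoset Γ c ℓ₁ ℓ₂) : Set (suc (c ⊔ ℓ₁ ⊔ ℓ₂)) where
    open ColoredPoset Q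
    field
      G1-color    : ∀ a → IsChain (OfColor a)
      G1-adjacent : ∀ b c → b ∼ c → IsChain (OfColor b ∪ OfColor c)
      G2 : ∀ (_≼_ : Rel Carrier (c ⊔ ℓ₁ ⊔ ℓ₂)) → IsPartialOrder _≈_ _≼_ →
           (∀ a → ExtendsOrderOn (OfColor a) _≼_) →
           (∀ b c → b ∼ c → ExtendsOrderOn (OfColor b ∪ OfColor c) _≼_) →
           ∀ x y → x ≤ᴾ y → x ≼ y
      G3 : ∀ a → Σ (∃ (OfColor a) → ℤ) λ f →
           IsOrderIsomorphism (_≈_ on proj₁) _≡_ (_≤ᴾ_ on proj₁) _≤_ f
      G4 : ∀ a b x → a ∼ b → x ∈ OfColor a → ∃[ y ] y ∈ OfColor b × Neighbors x y
      G5 : ∀ a x y → Consecutive a x y →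
           HasSum [ x , y ] (λ z → θ (κ z) a) (+ 2)

  -- P is identified with its image: an up-closed subset of Q whose order and
  -- coloring are those induced from Q.
  record IsFilterOf (P Q : ColoredPoset Γ c ℓ₁ ℓ₂) : Set (c ⊔ ℓ₁ ⊔ ℓ₂) where
    private
      module P = ColoredPoset P
      module Q = ColoredPoset Q
    field
      ι        : P.Carrier → Q.Carrier
      ι-mono   : IsOrderMonomorphism P._≈_ Q._≈_ P._≤ᴾ_ Q._≤ᴾ_ ι
      ι-color  : ∀ x → Q.κ (ι x) ≡ P.κ x
      upClosed : ∀ x q → ι x Q.≤ᴾ q → ∃[ y ] ι y Q.≈ q

{-# OPTIONS --safe #-}

-- A heap over Γ is read off from a word in the colors, and the conditions on
-- consecutive elements say that the charge of a color (the total weight of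
-- the adjacent letters since its last occurrence) is exactly 2 whenever the
-- color occurs again.
--
-- Let P be d-complete, connected and infinite. By UCB1 and connectedness the
-- sets P_a are either all bounded above or all unbounded above. If they are
-- all bounded, list P from the top. The recurring colors have only finitely
-- many charge states, so two cuts of the list have equal states. The letters
-- read upwards between these cuts can then be replayed above the upper cut,
-- again and again: UCB1 forbids that an available letter is missing. This
-- contradicts the finiteness of the part above the cut.
--
-- If they are all unbounded, list a suitable filter of P from the bottom.
-- Again two states agree, and repeating the letters between them extends the
-- word periodically downwards to a word indexed by ℤ, whose heap is the full
-- heap Q. The rest of P is mapped to Q by descending along each color. That
-- this preserves and reflects the order is shown from the top down: between
-- consecutive elements of a color, P embeds into Q, and the total weight is 2
-- on both sides, so nothing of Q is missed.
module Submission where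

open import Defs
open import Level using (Level; _⊔_; Lift; lift; lower; 0ℓ)
open import Axiom.ExcludedMiddle using (ExcludedMiddle)
open import Data.Empty using (⊥)
open import Data.Fin.Base as Fin using (Fin; toℕ; fromℕ<; funToFin; finToFun)
import Data.Fin.Properties as Fin
open import Data.Integer.Base as ℤ using (ℤ; 0ℤ; 1ℤ; +_; -[1+_]; +<+; -<+; -<-; +≤+; -≤+)
import Data.Integer.Properties as ℤ
open import Data.List.Base using (List; []; _∷_; _++_; concat; foldr; length; map; tabulate)
import Data.List.Membership.Setoid as Membership
import Data.List.Membership.Setoid.Properties as Membershipₚ
open import Data.List.Relation.Unary.AllPairs using ([]; _∷_)
open import Data.List.Relation.Unary.Any using (here; there; any?)
import Data.List.Relation.Unary.Any.Properties as Any
import Data.List.Relation.Unary.Unique.Setoid as UniqueSetoid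
import Data.List.Relation.Unary.Unique.Setoid.Properties as Uniqueₚ
open import Data.Nat.Base as ℕ using (ℕ; zero; suc; z≤n; s≤s)
import Data.Nat.Properties as ℕ
open import Data.Product.Base as Product using (Σ; ∃; ∃-syntax; ∃₂; _×_; _,_; proj₁; proj₂)
open import Data.Sum.Base as Sum using (_⊎_; inj₁; inj₂; [_,_]′)
open import Data.Unit.Base using (⊤; tt)
open import Function.Base using (_∘_; flip; id; _on_)
open import Function.Bundles using (_⇔_; mk⇔; Equivalence; Surjection)
open import Induction.WellFounded using (Acc; acc)
open import Relation.Binary.Bundles using (Setoid; Poset)
open import Relation.Binary.Construct.Closure.ReflexiveTransitive using (Star; ε; _◅_; _◅◅_)
open import Relation.Binary.Core using (Rel)
open import Relation.Binary.Definitions using (Decidable; tri<; tri≈; tri>)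
open import Relation.Binary.Morphism.Structures using (IsOrderIsomorphism; IsOrderMonomorphism)
import Relation.Binary.Properties.Poset as PosetProperties
open import Relation.Binary.PropositionalEquality
  using (_≡_; _≢_; refl; sym; trans; cong; cong₂; subst; subst₂; module ≡-Reasoning)
open import Relation.Binary.Structures using (IsPartialOrder)
open import Relation.Nullary.Decidable.Core
  using (Dec; yes; no; decidable-stable; map′; _×-dec_; ¬?)
open import Relation.Nullary.Negation.Core using (¬_; contradiction)
import Relation.Unary as Unary
open import Relation.Unary using (Pred; U)

-- Finite sums and locally finite posets

-- The constant 2 bounds the states: the weight collected since the last occurrence of a color and
-- the weight still to come before the next one add up to 2, so every charge is 0, 1 or 2. Some
-- obstacles shape the rest. In the bounded case a color may a priori occur only finitely often, and
-- below its lowest occurrence it has no charge; the replay keeps account of the recurrent colors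
-- only and lets all other letters pass. In the unbounded case an element may have infinitely many
-- elements below it, so a listing from the bottom is possible only after cutting off what lies
-- below a suitable `t₀`. A greedy listing could still starve some element forever; this is excluded
-- by spreading recurrence from one color to the others along the diagram. Finally, the part cut off
-- is not known to be periodic, while the extension is periodic by construction, so the two can only
-- be matched by counting weights. Throughout, order is tested on elements of equal or adjacent
-- colors only, since covers in `P` and the generating steps of `Q` join such elements.

module Summation {c ℓ} (S : Setoid c ℓ) where
  open Setoid S using (Carrier; _≈_) renaming (refl to ≈-refl; sym to ≈-sym; trans to ≈-trans)
  open Membership S using (_∈_; _∉_)
  open Membershipₚ using (∉⇒All[≉]; All[≉]⇒∉; ∈-resp-≈)
  open UniqueSetoid S using (Unique)

  sum : (Carrier → ℤ) → List Carrier → ℤ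
  sum f xs = foldr ℤ._+_ 0ℤ (map f xs)

  Congruent : (Carrier → ℤ) → Set (c ⊔ ℓ)
  Congruent f = ∀ {x y} → x ≈ y → f x ≡ f y

  unique-∷ : ∀ {x xs} → x ∉ xs → Unique xs → Unique (x ∷ xs)
  unique-∷ x∉ u = ∉⇒All[≉] S x∉ ∷ u

  unique-head : ∀ {x xs} → Unique (x ∷ xs) → x ∉ xs
  unique-head (x≉ ∷ _) = All[≉]⇒∉ S x≉

  unique-tail : ∀ {x xs} → Unique (x ∷ xs) → Unique xs
  unique-tail (_ ∷ u) = u

  record Removal (x : Carrier) (xs : List Carrier) : Set (c ⊔ ℓ) where
    field
      rest   : List Carrier
      shrink : length xs ≡ suc (length rest)
      sub    : ∀ {z} → z ∈ rest → z ∈ xs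
      cover  : ∀ {z} → z ∈ xs → z ≈ x ⊎ z ∈ rest
      total  : ∀ {f} → Congruent f → sum f xs ≡ f x ℤ.+ sum f rest
      fresh  : Unique xs → x ∉ rest
      unique : Unique xs → Unique rest

  remove : ∀ {x xs} → x ∈ xs → Removal x xs
  remove {x} {y ∷ ys} (here x≈y) = record
    { rest   = ys
    ; shrink = refl
    ; sub    = there
    ; cover  = λ { (here z≈y) → inj₁ (≈-trans z≈y (≈-sym x≈y)) ; (there z∈) → inj₂ z∈ }
    ; total  = λ {f} f-cong → cong (λ i → i ℤ.+ sum f ys) (f-cong (≈-sym x≈y))
    ; fresh  = λ u x∈ → unique-head u (∈-resp-≈ S x≈y x∈)
    ; unique = unique-tail
    }
  remove {x} {y ∷ ys} (there x∈) = record
    { rest   = y ∷ rest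
    ; shrink = cong suc shrink
    ; sub    = λ { (here z≈y) → here z≈y ; (there z∈) → there (sub z∈) }
    ; cover  = λ { (here z≈y) → inj₂ (here z≈y) ; (there z∈) → cover′ (cover z∈) }
    ; total  = λ {f} f-cong → trans (cong (λ r → f y ℤ.+ r) (total f-cong)) (swap (f y) (f x) (sum f rest))
    ; fresh  = λ { u (here x≈y) → unique-head u (∈-resp-≈ S x≈y x∈)
                 ; u (there x∈r) → fresh (unique-tail u) x∈r }
    ; unique = λ u → unique-∷ (unique-head u ∘ sub) (unique (unique-tail u))
    }
    where
    open Removal (remove x∈)
    cover′ : ∀ {z} → z ≈ x ⊎ z ∈ rest → z ≈ x ⊎ z ∈ (y ∷ rest)
    cover′ (inj₁ z≈x) = inj₁ z≈x
    cover′ (inj₂ z∈)  = inj₂ (there z∈)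
    swap : ∀ i j k → i ℤ.+ (j ℤ.+ k) ≡ j ℤ.+ (i ℤ.+ k)
    swap i j k = trans (sym (ℤ.+-assoc i j k)) (trans (cong (ℤ._+ k) (ℤ.+-comm i j)) (ℤ.+-assoc j i k))

  drop-head : ∀ {x z xs} → ¬ z ≈ x → z ∈ (x ∷ xs) → z ∈ xs
  drop-head z≉x (here z≈x) = contradiction z≈x z≉x
  drop-head z≉x (there z∈) = z∈

  module _ {f : Carrier → ℤ} (f-cong : Congruent f) where

    sum-zero : ∀ xs → (∀ {z} → z ∈ xs → f z ≡ 0ℤ) → sum f xs ≡ 0ℤ
    sum-zero []       f≡0 = refl
    sum-zero (x ∷ xs) f≡0 = cong₂ ℤ._+_ (f≡0 (here ≈-refl)) (sum-zero xs (f≡0 ∘ there))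

    private
      0+ : ∀ {i j} → i ≡ 0ℤ → i ℤ.+ j ≡ j
      0+ {j = j} refl = ℤ.+-identityˡ j

      drop-zero : ∀ {x z xs} → f x ≡ 0ℤ → f z ≢ 0ℤ → z ∈ (x ∷ xs) → z ∈ xs
      drop-zero fx≡0 fz≢0 (here z≈x) = contradiction (trans (f-cong z≈x) fx≡0) fz≢0
      drop-zero fx≡0 fz≢0 (there z∈) = z∈

      not-head : ∀ {x z xs} → x ∉ xs → z ∈ xs → ¬ z ≈ x
      not-head x∉ z∈ z≈x = x∉ (∈-resp-≈ S z≈x z∈)

      in-rest : ∀ {x z xs} (r : Removal x xs) → ¬ z ≈ x → z ∈ xs → z ∈ Removal.rest r
      in-rest r z≉x z∈ with Removal.cover r z∈
      ... | inj₁ z≈x = contradiction z≈x z≉x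
      ... | inj₂ z∈r = z∈r

    -- Membership has to match only where `f` is nonzero: a stretch of a word also holds letters
    -- that are not adjacent to the color in question, and these need not lie in the interval it is
    -- compared with.
    sum-agree : ∀ {xs ys} → Unique xs → Unique ys →
                (∀ {z} → f z ≢ 0ℤ → z ∈ xs → z ∈ ys) →
                (∀ {z} → f z ≢ 0ℤ → z ∈ ys → z ∈ xs) → sum f xs ≡ sum f ys
    sum-agree {[]} {ys} _ _ _ ys⊆ = sym (sum-zero ys λ {z} z∈ →
      decidable-stable (f z ℤ.≟ 0ℤ) λ fz≢0 → ∉[] (ys⊆ fz≢0 z∈))
      where
      ∉[] : ∀ {z} → z ∉ []
      ∉[] ()
    sum-agree {x ∷ xs} {ys} ux uy xs⊆ ys⊆ with f x ℤ.≟ 0ℤ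
    ... | yes fx≡0 = trans (0+ fx≡0)
      (sum-agree (unique-tail ux) uy (λ fz≢0 → xs⊆ fz≢0 ∘ there)
        (λ fz≢0 → drop-zero fx≡0 fz≢0 ∘ ys⊆ fz≢0))
    ... | no fx≢0 = trans (cong (λ r → f x ℤ.+ r)
        (sum-agree (unique-tail ux) (unique uy)
          (λ fz≢0 z∈ → in-rest r (not-head (unique-head ux) z∈) (xs⊆ fz≢0 (there z∈)))
          (λ fz≢0 z∈ → drop-head (not-head (fresh uy) z∈) (ys⊆ fz≢0 (sub z∈)))))
        (sym (total f-cong))
      where
      r : Removal x ys
      r = remove (xs⊆ fx≢0 (here ≈-refl))
      open Removal r

    sum-mono : ∀ {xs ys} → (∀ {z} → z ∈ ys → 0ℤ ℤ.≤ f z) → Unique xs →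
               (∀ {z} → f z ≢ 0ℤ → z ∈ xs → z ∈ ys) → sum f xs ℤ.≤ sum f ys
    sum-mono {[]}     {ys} f≥0 _  _   = nonneg ys f≥0
      where
      nonneg : ∀ zs → (∀ {z} → z ∈ zs → 0ℤ ℤ.≤ f z) → 0ℤ ℤ.≤ sum f zs
      nonneg []       _   = ℤ.≤-refl
      nonneg (z ∷ zs) f≥0 = ℤ.+-mono-≤ (f≥0 (here ≈-refl)) (nonneg zs (f≥0 ∘ there))
    sum-mono {x ∷ xs} {ys} f≥0 ux xs⊆ with f x ℤ.≟ 0ℤ
    ... | yes fx≡0 = subst (ℤ._≤ _) (sym (0+ fx≡0))
      (sum-mono f≥0 (unique-tail ux) (λ fz≢0 → xs⊆ fz≢0 ∘ there))
    ... | no fx≢0 = subst (_ ℤ.≤_) (sym (total f-cong)) (ℤ.+-monoʳ-≤ (f x)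
        (sum-mono (f≥0 ∘ sub) (unique-tail ux)
          (λ fz≢0 z∈ → in-rest r (not-head (unique-head ux) z∈) (xs⊆ fz≢0 (there z∈)))))
      where
      r : Removal x ys
      r = remove (xs⊆ fx≢0 (here ≈-refl))
      open Removal r

module FinitePoset {c ℓ₁ ℓ₂} (P : Poset c ℓ₁ ℓ₂)
                   (_≤?_ : Decidable (Poset._≤_ P)) where
  open Poset P using (Carrier; _≈_; _≤_; antisym; module Eq)
    renaming (refl to ≤-refl; trans to ≤-trans; reflexive to ≤-reflexive)
  open PosetProperties P using (_<_; <-trans; <-irrefl; <-respˡ-≈; <-respʳ-≈; ≤-dec⇒≈-dec)
  open Membership Eq.setoid using (_∈_; _∉_)
  open Summation Eq.setoid

  _≈?_ : Decidable _≈_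
  _≈?_ = ≤-dec⇒≈-dec _≤?_

  _<?_ : Decidable _<_
  x <? y = (x ≤? y) ×-dec ¬? (x ≈? y)

  <-≤-trans : ∀ {x y z} → x < y → y ≤ z → x < z
  <-≤-trans (x≤y , x≉y) y≤z = ≤-trans x≤y y≤z ,
    λ x≈z → x≉y (antisym x≤y (≤-trans y≤z (≤-reflexive (Eq.sym x≈z))))

  minimal : ∀ {r} {R : Pred Carrier r} → Unary.Decidable R → (∀ {x y} → x ≈ y → R x → R y) →
            ∀ M {x} → R x → (∀ v → v < x → R v → v ∈ M) →
            ∃ λ m → R m × m ≤ x × (∀ v → v < m → ¬ R v)
  minimal R? R-resp []      {x} Rx below = x , Rx , ≤-refl , λ v v<x Rv → ∉[] (below v v<x Rv)
    where
    ∉[] : ∀ {z} → z ∉ []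
    ∉[] ()
  minimal R? R-resp (y ∷ M) {x} Rx below with R? y ×-dec (y <? x)
  ... | yes (Ry , y<x) =
    let m , Rm , m≤y , min = minimal R? R-resp M Ry λ v v<y Rv →
          drop-head (λ v≈y → <-irrefl v≈y v<y) (below v (<-trans v<y y<x) Rv)
    in m , Rm , ≤-trans m≤y (proj₁ y<x) , min
  ... | no ¬y = minimal R? R-resp M Rx λ v v<x Rv →
          drop-head (λ v≈y → ¬y (R-resp v≈y Rv , <-respˡ-≈ v≈y v<x)) (below v v<x Rv)

  -- Here `v` counts as the smaller argument, so accessibility means that strict ascents staying
  -- below `y` come to an end. This is the induction that local finiteness supplies, as the order
  -- itself need not be well-founded in either direction.
  Climb : Carrier → Rel Carrier _
  Climb y v u = u < v × v ≤ y

  climb-wf : ∀ {y} → (∀ x → ∃[ M ] (∀ v → x ≤ v → v ≤ y → v ∈ M)) → ∀ x → Acc (Climb y) x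
  climb-wf {y} finite x =
    let M , covers = finite x
    in go (length M) M refl (λ v x<v v≤y → covers v (proj₁ x<v) v≤y)
    where
    go : ∀ {x} n M → length M ≡ n → (∀ v → x < v → v ≤ y → v ∈ M) → Acc (Climb y) x
    go zero [] refl covers = acc λ (x<v , v≤y) → contradiction (covers _ x<v v≤y) λ ()
    go (suc n) M len covers = acc λ {v} (x<v , v≤y) →
      let module R = Removal (remove (covers v x<v v≤y))
      in go n R.rest (ℕ.suc-injective (trans (sym R.shrink) len)) λ u v<u u≤y →
           pick (λ u≈v → <-irrefl (Eq.sym u≈v) v<u) (R.cover (covers u (<-trans x<v v<u) u≤y))
      where
      pick : ∀ {u v r} → ¬ u ≈ v → u ≈ v ⊎ u ∈ r → u ∈ r
      pick u≉v (inj₁ u≈v) = contradiction u≈v u≉v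
      pick u≉v (inj₂ u∈)  = u∈

  open PosetNotions P using (FiniteSubset)

  enumerate : ∀ {r} {R : Pred Carrier r} → Unary.Decidable R → (∀ {x y} → x ≈ y → R x → R y) →
              ∀ M → (∀ z → R z → z ∈ M) → FiniteSubset R
  enumerate {R = R} R? R-resp M covers =
    let xs , u , e = go M
    in xs , u , λ z → mk⇔ (proj₁ ∘ Equivalence.to (e z)) (λ Rz → Equivalence.from (e z) (Rz , covers z Rz))
    where
    go : ∀ M → FiniteSubset (λ z → R z × z ∈ M)
    go []      = [] , [] , λ z → mk⇔ (λ ()) (λ { (_ , ()) })
    go (y ∷ M) with go M
    ... | xs , u , e with R? y ×-dec ¬? (any? (y ≈?_) xs)
    ...   | yes (Ry , y∉xs) = y ∷ xs , unique-∷ y∉xs u , λ z → mk⇔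
      (λ { (here z≈y) → R-resp (Eq.sym z≈y) Ry , here z≈y
         ; (there z∈) → Product.map₂ there (Equivalence.to (e z) z∈) })
      (λ { (Rz , here z≈y) → here z≈y
         ; (Rz , there z∈) → there (Equivalence.from (e z) (Rz , z∈)) })
    ...   | no ¬y = xs , u , λ z → mk⇔ (Product.map₂ there ∘ Equivalence.to (e z))
      (λ { (Rz , here z≈y) → Membershipₚ.∈-resp-≈ Eq.setoid (Eq.sym z≈y)
             (decidable-stable (any? (y ≈?_) xs) λ y∉xs → ¬y (R-resp z≈y Rz , y∉xs))
         ; (Rz , there z∈) → Equivalence.from (e z) (Rz , z∈) })

-- Linear extensions and words

module Weights (Γ : DynkinDiagram) where
  open DynkinDiagram Γ

  wt : Color → Color → ℕ
  wt b a = ℤ.∣ θ b a ∣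

  -- The pairs of colors whose elements have to be comparable; as letters, the pairs that do not
  -- commute.
  Linked : Color → Color → Set
  Linked a b = a ≡ b ⊎ a ∼ b

  -θ≡wt : ∀ {b a} → b ≢ a → ℤ.- θ b a ≡ + wt b a
  -θ≡wt {b} {a} b≢a with θ b a | θ-off b≢a
  ... | + zero   | _ = refl
  ... | -[1+ _ ] | _ = refl
  ... | + suc _  | +≤+ ()

  ∼-sym : ∀ {a b} → a ∼ b → b ∼ a
  ∼-sym {a} {b} (a≢b , θ<0) = b≢a ,
    ℤ.≤∧≢⇒< (θ-off b≢a) λ θba≡0 → ℤ.<⇒≢ θ<0 (Equivalence.from θ-zero θba≡0)
    where
    b≢a : b ≢ a
    b≢a = a≢b ∘ sym

  Linked-sym : ∀ {a b} → Linked a b → Linked b a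
  Linked-sym (inj₁ a≡b) = inj₁ (sym a≡b)
  Linked-sym (inj₂ a∼b) = inj₂ (∼-sym a∼b)

  θ≢0⇒∼ : ∀ {a b} → a ≢ b → θ a b ≢ 0ℤ → a ∼ b
  θ≢0⇒∼ a≢b θ≢0 = a≢b , ℤ.≤∧≢⇒< (θ-off a≢b) θ≢0

  ∼⇒wt>0 : ∀ {a b} → a ∼ b → 0 ℕ.< wt a b
  ∼⇒wt>0 {a} {b} (_ , θ<0) with θ a b | θ<0
  ... | -[1+ _ ] | _ = s≤s z≤n
  ... | + _      | +<+ ()

  wt-zero-sym : ∀ {a b} → wt a b ≡ 0 → wt b a ≡ 0
  wt-zero-sym wt≡0 = cong ℤ.∣_∣ (Equivalence.to θ-zero (ℤ.∣i∣≡0⇒i≡0 wt≡0))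

  -θ≢0⇒θ≢0 : ∀ {a b} → ℤ.- θ a b ≢ 0ℤ → θ a b ≢ 0ℤ
  -θ≢0⇒θ≢0 -θ≢0 θ≡0 = -θ≢0 (cong ℤ.-_ θ≡0)

  -- Connectedness of the Dynkin diagram as an induction principle: what spreads along adjacency and
  -- holds for one color holds for all. The level is a parameter because the properties spread in
  -- this way speak of elements of the poset.
  ColorConnected : (ℓ : Level) → Set (Level.suc ℓ)
  ColorConnected ℓ = (X : Color → Set ℓ) → (∀ {a b} → a ∼ b → X a → X b) → ∀ {a b} → X a → X b

module Enumeration {c ℓ₁ ℓ₂} (O : Poset c ℓ₁ ℓ₂) (_≤?_ : Decidable (Poset._≤_ O))
  {d} {D : Pred (Poset.Carrier O) d} (D? : Unary.Decidable D)
  (D-down : ∀ {x y} → Poset._≤_ O x y → D y → D x) where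

  open Poset O using (Carrier; _≈_; _≤_; antisym; module Eq)
    renaming (refl to ≤-refl; trans to ≤-trans; reflexive to ≤-reflexive)
  open PosetProperties O using (_<_; <-trans; <-irrefl; <-respˡ-≈; <-respʳ-≈; ≤-dec⇒≈-dec)
  open Membership Eq.setoid using (_∈_; _∉_)
  open UniqueSetoid Eq.setoid using (Unique)
  open FinitePoset O _≤?_
  open Summation Eq.setoid

  -- A linear extension of type ω outside the down-set `D`. The greedy choice behind it is not fair,
  -- so a listing of everything outside `D` is not claimed here; `exhausts` proves it for the
  -- listing that needs it.
  record Sequence : Set (c ⊔ ℓ₁ ⊔ ℓ₂ ⊔ d) where
    field
      p        : ℕ → Carrier
      outside  : ∀ k → ¬ D (p k)
      distinct : ∀ {j k} → j ℕ.< k → ¬ p k ≈ p j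
      below    : ∀ {z} k → z < p k → D z ⊎ ∃[ j ] j ℕ.< k × z ≈ p j

    index-unique : ∀ {j k} → p j ≈ p k → j ≡ k
    index-unique {j} {k} pj≈pk with ℕ.<-cmp j k
    ... | tri< j<k _ _ = contradiction (Eq.sym pj≈pk) (distinct j<k)
    ... | tri≈ _ j≡k _ = j≡k
    ... | tri> _ _ k<j = contradiction pj≈pk (distinct k<j)

    <⇒index< : ∀ {i j} → p i < p j → i ℕ.< j
    <⇒index< {i} {j} pi<pj with below j pi<pj
    ... | inj₁ Dpi             = contradiction Dpi (outside i)
    ... | inj₂ (k , k<j , i≈k) = subst (ℕ._< j) (sym (index-unique i≈k)) k<j

    index<⇒< : ∀ {i j} → i ℕ.< j → p i ≤ p j ⊎ p j ≤ p i → p i < p j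
    index<⇒< i<j (inj₁ pi≤pj) = pi≤pj , distinct i<j ∘ Eq.sym
    index<⇒< i<j (inj₂ pj≤pi) = contradiction i<j (ℕ.<-asym (<⇒index< (pj≤pi , distinct i<j)))

    -- Such an element is outside `D`, since `D` is down-closed and omits `p i`; hence `below` has
    -- to find it in the list.
    between : ∀ {i j z} → p i < z → z < p j → ∃[ k ] i ℕ.< k × k ℕ.< j × z ≈ p k
    between {i} {j} pi<z z<pj with below j z<pj
    ... | inj₁ Dz              = contradiction (D-down (proj₁ pi<z) Dz) (outside i)
    ... | inj₂ (k , k<j , z≈k) = k , <⇒index< (<-respʳ-≈ z≈k pi<z) , k<j , z≈k

    segment : ℕ → ℕ → List Carrier
    segment k zero    = []
    segment k (suc m) = p k ∷ segment (suc k) m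

    ∈-segment⁻ : ∀ k m {z} → z ∈ segment k m → ∃[ j ] k ℕ.≤ j × j ℕ.< k ℕ.+ m × z ≈ p j
    ∈-segment⁻ k (suc m) (here z≈) = k , ℕ.≤-refl , ℕ.m<m+n k (s≤s z≤n) , z≈
    ∈-segment⁻ k (suc m) (there z∈) =
      let j , k<j , j< , z≈ = ∈-segment⁻ (suc k) m z∈
      in j , ℕ.<⇒≤ k<j , subst (j ℕ.<_) (sym (ℕ.+-suc k m)) j< , z≈

    ∈-segment⁺ : ∀ k m {z j} → k ℕ.≤ j → j ℕ.< k ℕ.+ m → z ≈ p j → z ∈ segment k m
    ∈-segment⁺ k zero    k≤j j<k z≈ = contradiction k≤j (ℕ.<⇒≱ (subst (_ ℕ.<_) (ℕ.+-identityʳ k) j<k))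
    ∈-segment⁺ k (suc m) {j = j} k≤j j< z≈ with k ℕ.≟ j
    ... | yes refl = here z≈
    ... | no  k≢j  = there (∈-segment⁺ (suc k) m (ℕ.≤∧≢⇒< k≤j k≢j) (subst (j ℕ.<_) (ℕ.+-suc k m) j<) z≈)

    segment-unique : ∀ k m → Unique (segment k m)
    segment-unique k zero    = []
    segment-unique k (suc m) = unique-∷
      (λ pk∈ → let j , k<j , _ , pk≈ = ∈-segment⁻ (suc k) m pk∈ in distinct k<j (Eq.sym pk≈))
      (segment-unique (suc k) m)

  module _ (finite-below : ∀ y → ∃[ M ] (∀ z → z ≤ y → ¬ D z → z ∈ M))
           (unexhausted : ∀ L → ∃[ x ] ¬ D x × x ∉ L) where

    private
      choose : ∀ L → ∃[ x ] ¬ D x × x ∉ L × (∀ z → z < x → D z ⊎ z ∈ L)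
      choose L =
        let y , ¬Dy , y∉L = unexhausted L
            M , covers = finite-below y
            m , (¬Dm , m∉L) , _ , min =
              minimal R? R-resp M (¬Dy , y∉L) (λ v v<y Rv → covers v (proj₁ v<y) (proj₁ Rv))
        in m , ¬Dm , m∉L , λ z z<m → split z (min z z<m)
        where
        R : Pred Carrier _
        R z = ¬ D z × z ∉ L
        _∈?L : Unary.Decidable (_∈ L)
        z ∈?L = any? (z ≈?_) L
        R? : Unary.Decidable R
        R? z = ¬? (D? z) ×-dec ¬? (z ∈?L)
        R-resp : ∀ {x y} → x ≈ y → R x → R y
        R-resp x≈y (¬Dx , x∉L) =
          ¬Dx ∘ D-down (≤-reflexive x≈y) , x∉L ∘ Membershipₚ.∈-resp-≈ Eq.setoid (Eq.sym x≈y)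
        split : ∀ z → ¬ R z → D z ⊎ z ∈ L
        split z ¬Rz with D? z | z ∈?L
        ... | yes Dz | _       = inj₁ Dz
        ... | no  _  | yes z∈L = inj₂ z∈L
        ... | no ¬Dz | no  z∉L = contradiction (¬Dz , z∉L) ¬Rz

      history : ℕ → List Carrier
      history zero    = []
      history (suc k) = proj₁ (choose (history k)) ∷ history k

      point : ℕ → Carrier
      point k = proj₁ (choose (history k))

      ∈-history⁻ : ∀ k {z} → z ∈ history k → ∃[ j ] j ℕ.< k × z ≈ point j
      ∈-history⁻ (suc k) (here z≈) = k , ℕ.≤-refl , z≈
      ∈-history⁻ (suc k) (there z∈) = let j , j<k , z≈ = ∈-history⁻ k z∈ in j , ℕ.m<n⇒m<1+n j<k , z≈

      ∈-history⁺ : ∀ {j} k {z} → j ℕ.< k → z ≈ point j → z ∈ history k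
      ∈-history⁺ {j} (suc k) (s≤s j≤k) z≈ with j ℕ.≟ k
      ... | yes refl = here z≈
      ... | no  j≢k  = there (∈-history⁺ k (ℕ.≤∧≢⇒< j≤k j≢k) z≈)

    sequence : Sequence
    sequence = record
      { p        = point
      ; outside  = λ k → proj₁ (proj₂ (choose (history k)))
      ; distinct = λ {j} {k} j<k pk≈pj → proj₁ (proj₂ (proj₂ (choose (history k)))) (∈-history⁺ k j<k pk≈pj)
      ; below    = λ {z} k z<pk →
          [ inj₁ , inj₂ ∘ ∈-history⁻ k ]′ (proj₂ (proj₂ (proj₂ (choose (history k)))) z z<pk)
      }

module Words (Γ : DynkinDiagram) where
  open DynkinDiagram Γ
  open Weights Γ

  -- Till u a k m v: the first occurrence of a at or after position k is at
  -- k + m, and the letters from k up to it have total weight v.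
  data Till (u : ℕ → Color) (a : Color) : ℕ → ℕ → ℕ → Set where
    here  : ∀ {k} → u k ≡ a → Till u a k 0 0
    there : ∀ {k m v} → u k ≢ a → Till u a (suc k) m v → Till u a k (suc m) (wt (u k) a ℕ.+ v)

  record IsHeaped (u : ℕ → Color) : Set where
    field
      gap : ∀ {a i m v} → u i ≡ a → Till u a (suc i) m v → v ≡ 2

  module _ {u : ℕ → Color} {a : Color} where

    till-end : ∀ {k m v} → Till u a k m v → u (k ℕ.+ m) ≡ a
    till-end {k} (here uk≡a) = subst (λ i → u i ≡ a) (sym (ℕ.+-identityʳ k)) uk≡a
    till-end {k} (there {m = m} _ t) = subst (λ i → u i ≡ a) (sym (ℕ.+-suc k m)) (till-end t)

    till-free : ∀ {k m v j} → Till u a k m v → k ℕ.≤ j → j ℕ.< k ℕ.+ m → u j ≢ a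
    till-free {k} (here _) k≤j j<k = contradiction k≤j (ℕ.<⇒≱ (subst (_ ℕ.<_) (ℕ.+-identityʳ k) j<k))
    till-free {k} {j = j} (there {m = m} uk≢a t) k≤j j< with k ℕ.≟ j
    ... | yes refl = uk≢a
    ... | no  k≢j  = till-free t (ℕ.≤∧≢⇒< k≤j k≢j) (subst (j ℕ.<_) (ℕ.+-suc k m) j<)

    till-exists : ∀ {k j} → k ℕ.≤ j → u j ≡ a → ∃₂ λ m v → Till u a k m v
    till-exists {k} {j} k≤j uj≡a = go (j ℕ.∸ k) (subst (λ i → u i ≡ a) (sym (ℕ.m+[n∸m]≡n k≤j)) uj≡a)
      where
      go : ∀ d {k} → u (k ℕ.+ d) ≡ a → ∃₂ λ m v → Till u a k m v
      go zero    {k} uk≡a = 0 , 0 , here (subst (λ i → u i ≡ a) (ℕ.+-identityʳ k) uk≡a)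
      go (suc d) {k} u≡a with u k Fin.≟ a
      ... | yes uk≡a = 0 , 0 , here uk≡a
      ... | no  uk≢a = let m , v , t = go d (subst (λ i → u i ≡ a) (ℕ.+-suc k d) u≡a)
                       in suc m , wt (u k) a ℕ.+ v , there uk≢a t

    till-functional : ∀ {k m m′ v v′} → Till u a k m v → Till u a k m′ v′ → v ≡ v′
    till-functional (here _)      (here _)       = refl
    till-functional (here uk≡a)   (there uk≢a _) = contradiction uk≡a uk≢a
    till-functional (there uk≢a _) (here uk≡a)   = contradiction uk≡a uk≢a
    till-functional (there _ t)   (there _ t′)   = cong (wt _ a ℕ.+_) (till-functional t t′)

module _ {Γ : DynkinDiagram} {c ℓ₁ ℓ₂ : Level} where
  open DynkinDiagram Γ
  open Weights Γ
  open Words Γ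

  -- A part of the d-complete axioms that survives reversal of the order. It holds for `P`, for its
  -- dual and for the heap of a word, which lets them share lemmas.
  record IsHeapLike (P : ColoredPoset Γ c ℓ₁ ℓ₂) : Set (c ⊔ ℓ₁ ⊔ ℓ₂) where
    open ColoredPoset P
    field
      linked-comparable : ∀ x y → Linked (κ x) (κ y) → Comparable x y
      ice : ∀ {a x y} → Consecutive a x y → HasSum ⦅ x , y ⦆ (λ z → ℤ.- θ (κ z) a) (+ 2)

  dual : ColoredPoset Γ c ℓ₁ ℓ₂ → ColoredPoset Γ c ℓ₁ ℓ₂
  dual P = record
    { poset         = PosetProperties.≥-poset poset
    ; locallyFinite = λ x y → Product.map₂ (Product.map₂ (flipped ∘_)) (locallyFinite y x)
    ; coloring      = coloring
    }
    where
    open ColoredPoset P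
    flipped : ∀ {A : Set (c ⊔ ℓ₁)} {x y z} → A ⇔ (x ≤ᴾ z × z ≤ᴾ y) → A ⇔ (z ≤ᴾ y × x ≤ᴾ z)
    flipped e = mk⇔ (Product.swap ∘ Equivalence.to e) (Equivalence.from e ∘ Product.swap)

  module _ (P : ColoredPoset Γ c ℓ₁ ℓ₂) where
    open ColoredPoset P
    private
      module P = Poset poset
      module D = ColoredPoset (dual P)

    dual-< : ∀ {x y} → x D.<ᴾ y → y <ᴾ x
    dual-< (y≤x , x≉y) = y≤x , x≉y ∘ P.Eq.sym

    dual-<⁻ : ∀ {x y} → y <ᴾ x → x D.<ᴾ y
    dual-<⁻ (y≤x , y≉x) = y≤x , y≉x ∘ P.Eq.sym

    dual-heapLike : IsHeapLike P → IsHeapLike (dual P)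
    dual-heapLike h = record
      { linked-comparable = λ x y l → Sum.swap (linked-comparable x y l)
      ; ice = λ {a} {x} {y} (x<y , κx≡a , κy≡a , gap) →
          let xs , (u , e) , s = ice {a} {y} {x} (dual-< x<y , κy≡a , κx≡a ,
                λ z (y<z , z<x) → gap z (dual-<⁻ z<x , dual-<⁻ y<z))
          in xs , (u , λ z → mk⇔ (λ z∈ → let y<z , z<x = Equivalence.to (e z) z∈ in dual-<⁻ z<x , dual-<⁻ y<z)
                              (λ (x<z , z<y) → Equivalence.from (e z) (dual-< z<y , dual-< x<z))) , s
      }
      where open IsHeapLike h

    dComplete⇒heapLike : IsDComplete P → IsHeapLike P
    dComplete⇒heapLike d = record
      { linked-comparable = λ x y → [ EC x y , AC x y ]′
      ; ice = λ {a} {x} {y} → ICE2 a x y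
      }
      where open IsDComplete d

  module SequenceWord (P : ColoredPoset Γ c ℓ₁ ℓ₂) (heapLike : IsHeapLike P)
    (_≤?_ : Decidable (ColoredPoset._≤ᴾ_ P))
    {d} {D : Pred (ColoredPoset.Carrier P) d} (D? : Unary.Decidable D)
    (D-down : ∀ {x y} → ColoredPoset._≤ᴾ_ P x y → D y → D x)
    (s : Enumeration.Sequence (ColoredPoset.poset P) _≤?_ D? D-down) where

    open ColoredPoset P
    open Poset poset using (module Eq) renaming (refl to ≤-refl)
    open IsHeapLike heapLike
    open PosetProperties poset using (<-trans; <-irrefl; <-respˡ-≈; <-respʳ-≈)
    open Membership Eq.setoid using (_∈_; _∉_)
    open Summation Eq.setoid using (sum; sum-agree)
    open Enumeration.Sequence s

    word : ℕ → Color
    word k = κ (p k)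

    κ-cong : ∀ {x y} → x ≈ y → κ x ≡ κ y
    κ-cong = Surjection.cong coloring

    weight : Color → Carrier → ℤ
    weight a z = ℤ.- θ (κ z) a

    segment-sum : ∀ {a k m v} → Till word a k m v → sum (weight a) (segment k m) ≡ + v
    segment-sum (here _)       = refl
    segment-sum (there uk≢a t) = cong₂ ℤ._+_ (-θ≡wt uk≢a) (segment-sum t)

    -- The set `A` is left general for two uses: the open interval between consecutive elements, and
    -- the set in UCB1 above a maximal element of its color.
    till-sum : ∀ {ℓ a k m v t} {A : Pred Carrier ℓ} → Till word a k m v → HasSum A (weight a) t →
               (∀ {z} → A z → κ z ∼ a → ∃[ j ] k ℕ.≤ j × j ℕ.< k ℕ.+ m × z ≈ p j) →
               (∀ {j} → k ℕ.≤ j → j ℕ.< k ℕ.+ m → word j ∼ a → A (p j)) →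
               (∀ {z} → A z → κ z ≢ a) → t ≡ + v
    till-sum {a = a} {k} {m} till (xs , (xs! , xs↔A) , total) A⇒ ⇒A A-free = trans (sym total) (trans
      (sum-agree (λ x≈y → cong (λ b → ℤ.- θ b a) (κ-cong x≈y)) xs! (segment-unique k m)
        (λ {z} w≢0 z∈xs →
          let Az = Equivalence.to (xs↔A z) z∈xs
              j , k≤j , j< , z≈ = A⇒ Az (θ≢0⇒∼ (A-free Az) (-θ≢0⇒θ≢0 w≢0))
          in ∈-segment⁺ k m k≤j j< z≈)
        (λ {z} w≢0 z∈ →
          let j , k≤j , j< , z≈ = ∈-segment⁻ k m z∈
              κz≢a = λ κz≡a → till-free till k≤j j< (trans (sym (κ-cong z≈)) κz≡a)
              κz∼a = θ≢0⇒∼ κz≢a (-θ≢0⇒θ≢0 w≢0)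
          in Membershipₚ.∈-resp-≈ Eq.setoid (Eq.sym z≈)
               (Equivalence.from (xs↔A (p j)) (⇒A k≤j j< (subst (_∼ a) (κ-cong z≈) κz∼a)))))
      (segment-sum till))

    heaped : IsHeaped word
    heaped = record { gap = gap }
      where
      -- A listed element whose color is adjacent to `a` is comparable with both ends, so an index
      -- between theirs puts it into the open interval. The other letters in between weigh nothing.
      gap : ∀ {a i m v} → word i ≡ a → Till word a (suc i) m v → v ≡ 2
      gap {a} {i} {m} {v} κi≡a till = ℤ.+-injective (sym (till-sum till (ice consecutive) inside
          (λ {k} i<k k<j κk∼a →
            index<⇒< i<k (linked-comparable _ _ (Linked-sym (inj₂ (subst (word k ∼_) (sym κi≡a) κk∼a)))) ,
            index<⇒< k<j (linked-comparable _ _ (inj₂ (subst (word k ∼_) (sym κj≡a) κk∼a))))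
          (λ A → proj₂ (proj₂ (proj₂ consecutive)) _ A)))
        where
        j = suc i ℕ.+ m
        κj≡a : word j ≡ a
        κj≡a = till-end till
        pi<pj : p i <ᴾ p j
        pi<pj = index<⇒< (ℕ.m≤m+n (suc i) m) (linked-comparable _ _ (inj₁ (trans κi≡a (sym κj≡a))))
        consecutive : Consecutive a (p i) (p j)
        consecutive = pi<pj , κi≡a , κj≡a , λ z (i<z , z<j) κz≡a →
          let k , i<k , k<j , z≈ = between i<z z<j
          in till-free till i<k k<j (trans (sym (κ-cong z≈)) κz≡a)
        inside : ∀ {z} → ⦅ p i , p j ⦆ z → κ z ∼ a → ∃[ k ] suc i ℕ.≤ k × k ℕ.< suc i ℕ.+ m × z ≈ p k
        inside (i<z , z<j) _ = between i<z z<j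

-- Charges, firing and replay

module Firing (Γ : DynkinDiagram) where
  open DynkinDiagram Γ
  open Weights Γ

  -- If `σ b` is 2, this subtracts row `b` of `θ` from `σ`: it is a chip-firing move at the vertex
  -- `b`.
  step : Color → (Color → ℕ) → Color → ℕ
  step b σ a with a Fin.≟ b
  ... | yes _ = 0
  ... | no  _ = σ a ℕ.+ wt b a

  step-hit : ∀ {b σ a} → a ≡ b → step b σ a ≡ 0
  step-hit {b} {σ} {a} a≡b with a Fin.≟ b
  ... | yes _  = refl
  ... | no a≢b = contradiction a≡b a≢b

  step-miss : ∀ {b σ a} → a ≢ b → step b σ a ≡ σ a ℕ.+ wt b a
  step-miss {b} {σ} {a} a≢b with a Fin.≟ b
  ... | yes a≡b = contradiction a≡b a≢b
  ... | no _    = refl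

  step-cong : ∀ {b σ τ a} → σ a ≡ τ a → step b σ a ≡ step b τ a
  step-cong {b} {σ} {τ} {a} σ≡τ with a Fin.≟ b
  ... | yes _ = refl
  ... | no  _ = cong (ℕ._+ wt b a) σ≡τ

  step-comm : ∀ {b c σ} a → b ≢ c → wt b c ≡ 0 → wt c b ≡ 0 → step b (step c σ) a ≡ step c (step b σ) a
  step-comm {b} {c} {σ} a b≢c wbc wcb with a Fin.≟ b | a Fin.≟ c
  ... | yes refl | yes refl = contradiction refl b≢c
  ... | yes refl | no a≢c   = sym (trans (cong (ℕ._+ wt c b) (step-hit {b} {σ} refl)) wcb)
  ... | no a≢b   | yes refl = trans (cong (ℕ._+ wt b c) (step-hit {c} {σ} refl)) wbc
  ... | no a≢b   | no a≢c   = begin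
    step c σ a ℕ.+ wt b a      ≡⟨ cong (ℕ._+ wt b a) (step-miss {c} {σ} a≢c) ⟩
    σ a ℕ.+ wt c a ℕ.+ wt b a  ≡⟨ ℕ.+-assoc (σ a) _ _ ⟩
    σ a ℕ.+ (wt c a ℕ.+ wt b a) ≡⟨ cong (σ a ℕ.+_) (ℕ.+-comm (wt c a) _) ⟩
    σ a ℕ.+ (wt b a ℕ.+ wt c a) ≡⟨ ℕ.+-assoc (σ a) _ _ ⟨
    σ a ℕ.+ wt b a ℕ.+ wt c a  ≡⟨ cong (ℕ._+ wt c a) (step-miss {b} {σ} a≢b) ⟨
    step b σ a ℕ.+ wt c a      ∎
    where open ≡-Reasoning

  -- The charges are part of the data, because on ℤ there is no first position from which to compute
  -- them.
  record BiInfiniteWord : Set where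
    field
      letter : ℤ → Color
      charge : ℤ → Color → ℕ
      charge-step : ∀ i a → charge (ℤ.suc i) a ≡ step (letter i) (charge i) a
      ready  : ∀ i → charge i (letter i) ≡ 2
      later  : ∀ i a → ∃[ j ] i ℤ.< j × letter j ≡ a
      sooner : ∀ i a → ∃[ j ] j ℤ.< i × letter j ≡ a

  module Replay (I : Color → Set) where

    -- The list stands for the letters between a cut and the top of the poset, read upwards. The
    -- bound 1 at its end is the one of UCB1, and letters outside `I` may fire at any charge.
    Legal : (Color → ℕ) → List Color → Set
    Legal σ []      = ∀ a → I a → σ a ℕ.≤ 1
    Legal σ (b ∷ ℓ) = (I b → σ b ≡ 2) × Legal (step b σ) ℓ

    infix 4 _≐_
    _≐_ : (σ τ : Color → ℕ) → Set
    σ ≐ τ = ∀ a → I a → σ a ≡ τ a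

    step-≐ : ∀ {b σ τ} → σ ≐ τ → step b σ ≐ step b τ
    step-≐ {b} {σ} {τ} σ≐τ a Ia = step-cong {b} {σ} {τ} (σ≐τ a Ia)

    legal-≐ : ∀ {σ τ} ℓ → σ ≐ τ → Legal σ ℓ → Legal τ ℓ
    legal-≐ []      σ≐τ legal a Ia = subst (ℕ._≤ 1) (σ≐τ a Ia) (legal a Ia)
    legal-≐ (b ∷ ℓ) σ≐τ (σb≡2 , legal) =
      (λ Ib → trans (sym (σ≐τ b Ib)) (σb≡2 Ib)) , legal-≐ ℓ (step-≐ σ≐τ) legal

    -- The charge of `a` only grows until `a` is read, when it has to be 2, or until the end, when
    -- it is at most 1.
    legal-bound : ∀ {σ a} ℓ → I a → Legal σ ℓ → σ a ℕ.≤ 2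
    legal-bound []      Ia legal = ℕ.m≤n⇒m≤1+n (legal _ Ia)
    legal-bound {σ} {a} (b ∷ ℓ) Ia (σb≡2 , legal) with a Fin.≟ b
    ... | yes refl = ℕ.≤-reflexive (σb≡2 Ia)
    ... | no a≢b   = ℕ.≤-trans (ℕ.m≤m+n (σ a) (wt b a))
                       (subst (ℕ._≤ 2) (step-miss {b} {σ} a≢b) (legal-bound ℓ Ia legal))

    -- A letter ready to fire commutes to the front: an adjacent letter read
    -- before it would push its charge above 2.
    pull : ∀ {σ a} ℓ → I a → σ a ≡ 2 → Legal σ ℓ →
           ∃[ ℓ′ ] length ℓ ≡ suc (length ℓ′) × Legal (step a σ) ℓ′
    pull []      Ia σa≡2 legal = contradiction (subst (ℕ._≤ 1) σa≡2 (legal _ Ia)) λ { (s≤s ()) }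
    pull {σ} {a} (b ∷ ℓ) Ia σa≡2 (σb≡2 , legal) with a Fin.≟ b
    ... | yes refl = ℓ , refl , legal
    ... | no a≢b   =
      let ℓ′ , len , legal′ = pull ℓ Ia (trans charge (ℕ.+-identityʳ 2)) legal
      in b ∷ ℓ′ , cong suc len ,
         (λ Ib → trans (step-miss {a} {σ} b≢a)
           (trans (cong₂ ℕ._+_ (σb≡2 Ib) (wt-zero-sym wba≡0)) (ℕ.+-identityʳ 2))) ,
         legal-≐ ℓ′ (λ d _ → step-comm {a} {b} {σ} d a≢b (wt-zero-sym wba≡0) wba≡0) legal′
      where
      b≢a : b ≢ a
      b≢a = a≢b ∘ sym
      wba≡0 : wt b a ≡ 0
      wba≡0 = ℕ.n≤0⇒n≡0 (ℕ.+-cancelˡ-≤ 2 _ 0 (subst (ℕ._≤ 2)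
        (trans (step-miss {b} {σ} a≢b) (cong (ℕ._+ wt b a) σa≡2)) (legal-bound ℓ Ia legal)))
      charge : step b σ a ≡ 2 ℕ.+ 0
      charge = trans (step-miss {b} {σ} a≢b) (cong₂ ℕ._+_ σa≡2 wba≡0)

    run : (Color → ℕ) → List Color → Color → ℕ
    run σ []      = σ
    run σ (b ∷ c) = run (step b σ) c

    Playable : (Color → ℕ) → List Color → Set
    Playable σ []      = ⊤
    Playable σ (b ∷ c) = (I b × σ b ≡ 2) × Playable (step b σ) c

    replay : ∀ {σ} ℓ c → Playable σ c → Legal σ ℓ →
             ∃[ ℓ′ ] length ℓ ≡ length c ℕ.+ length ℓ′ × Legal (run σ c) ℓ′
    replay ℓ []      _                  legal = ℓ , refl , legal
    replay ℓ (b ∷ c) ((Ib , σb≡2) , pl) legal =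
      let ℓ₁ , len₁ , legal₁ = pull ℓ Ib σb≡2 legal
          ℓ₂ , len₂ , legal₂ = replay ℓ₁ c pl legal₁
      in ℓ₂ , trans len₁ (cong suc len₂) , legal₂

    -- Each round of the loop removes letters from `ℓ` and leads back to an equivalent state, so
    -- rounds could go on forever although `ℓ` is finite.
    no-loop : ∀ {σ} ℓ b c → Playable σ (b ∷ c) → run σ (b ∷ c) ≐ σ → ¬ Legal σ ℓ
    no-loop {σ} ℓ b c pl loop legal = go (length ℓ) ℓ ℕ.≤-refl legal
      where
      go : ∀ n ℓ → length ℓ ℕ.≤ n → ¬ Legal σ ℓ
      go n ℓ ℓ≤n legal with replay ℓ (b ∷ c) pl legal
      go zero    ℓ ℓ≤n legal | ℓ′ , len , _      = contradiction (subst (ℕ._≤ 0) len ℓ≤n) λ ()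
      go (suc n) ℓ ℓ≤n legal | ℓ′ , len , legal′ = go n ℓ′
        (ℕ.≤-trans (ℕ.m≤n+m _ (length c)) (ℕ.s≤s⁻¹ (subst (ℕ._≤ suc n) len ℓ≤n)))
        (legal-≐ ℓ′ loop legal′)

-- Infinite words

upperBound : ∀ {n} (g : Fin n → ℕ) → ∃[ N ] (∀ i → g i ℕ.≤ N)
upperBound {zero}  g = 0 , λ ()
upperBound {suc n} g =
  let N , g≤N = upperBound (g ∘ Fin.suc)
  in g Fin.zero ℕ.⊔ N , λ
    { Fin.zero    → ℕ.m≤m⊔n (g Fin.zero) N
    ; (Fin.suc i) → ℕ.≤-trans (g≤N i) (ℕ.m≤n⊔m (g Fin.zero) N) }

repetition : ∀ {n} (σ : ℕ → Fin n → ℕ) → (∀ k a → σ k a ℕ.≤ 2) →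
             ∃₂ λ i j → i ℕ.< j × (∀ a → σ i a ≡ σ j a)
repetition {n} σ σ≤2 =
  -- A state has one digit 0, 1 or 2 for each of the `n` colors and so is coded by a number below
  -- `3 ^ n`; one more than `3 ^ n` indices are compared.
  let i , j , i<j , same = Fin.pigeonhole {m = 3 ℕ.^ n} ℕ.≤-refl (λ k → funToFin (digit (toℕ k)))
  in toℕ i , toℕ j , i<j , λ a → begin
    σ (toℕ i) a                                ≡⟨ Fin.toℕ-fromℕ< (s≤s (σ≤2 (toℕ i) a)) ⟨
    toℕ (digit (toℕ i) a)                      ≡⟨ cong toℕ (Fin.finToFun-funToFin (digit (toℕ i)) a) ⟨
    toℕ (finToFun (funToFin (digit (toℕ i))) a) ≡⟨ cong (λ c → toℕ (finToFun {3} {n} c a)) same ⟩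
    toℕ (finToFun (funToFin (digit (toℕ j))) a) ≡⟨ cong toℕ (Fin.finToFun-funToFin (digit (toℕ j)) a) ⟩
    toℕ (digit (toℕ j) a)                      ≡⟨ Fin.toℕ-fromℕ< (s≤s (σ≤2 (toℕ j) a)) ⟩
    σ (toℕ j) a                                ∎
  where
  open ≡-Reasoning
  digit : ℕ → Fin n → Fin 3
  digit k a = fromℕ< (s≤s (σ≤2 k a))

module WordLimits (lem : ExcludedMiddle 0ℓ) (Γ : DynkinDiagram) where
  open DynkinDiagram Γ
  open Weights Γ
  open Words Γ
  open Firing Γ

  module _ (u : ℕ → Color) where

    Recurrent : Color → Set
    Recurrent a = ∀ k → ∃[ j ] k ℕ.≤ j × u j ≡ a

    Transient : Color → ℕ → Set
    Transient a k = ∀ j → k ℕ.≤ j → u j ≢ a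

    -- The index stands outside the sum so that `upperBound` can run over all colors at once; for a
    -- recurrent color it is the dummy 0.
    recurrent-or-transient : ∀ a → ∃[ k ] (Recurrent a ⊎ Transient a k)
    recurrent-or-transient a with lem {∃ (Transient a)}
    ... | yes (k , t) = k , inj₂ t
    ... | no ¬t = 0 , inj₁ λ k → recur k lem
      where
      recur : ∀ k → Dec (∃[ j ] k ℕ.≤ j × u j ≡ a) → ∃[ j ] k ℕ.≤ j × u j ≡ a
      recur k (yes r) = r
      recur k (no ¬r) = contradiction (k , λ j k≤j uj≡a → ¬r (j , k≤j , uj≡a)) ¬t

    eventually-recurrent : ∃[ K ] (∀ k → K ℕ.≤ k → Recurrent (u k))
    eventually-recurrent =
      let K , ≤K = upperBound (proj₁ ∘ recurrent-or-transient)
      in K , λ k K≤k → [ id , (λ t → contradiction refl (t k (ℕ.≤-trans (≤K (u k)) K≤k))) ]′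
                         (proj₂ (recurrent-or-transient (u k)))

  module _ {u : ℕ → Color} (heaped : IsHeaped u)
           (dominant : ∀ {a m v} → Till u a 0 m v → v ℕ.≤ 1) where
    open IsHeaped heaped
    open Replay (Recurrent u)

    private
      -- The charge of a at the cut k when the word is read backwards.
      charge : ∀ k a → Dec (Recurrent u a) → ℕ
      charge k a (yes r) = proj₁ (proj₂ (till-exists {u} {a} (proj₁ (proj₂ (r k))) (proj₂ (proj₂ (r k)))))
      charge k a (no _)  = 0

      σ : ℕ → Color → ℕ
      σ k a = charge k a lem

      σ-till : ∀ k a → Recurrent u a → ∃[ m ] Till u a k m (σ k a)
      σ-till k a r = go lem
        where
        go : (r? : Dec (Recurrent u a)) → ∃[ m ] Till u a k m (charge k a r?)
        go (yes r) = let t = till-exists {u} {a} (proj₁ (proj₂ (r k))) (proj₂ (proj₂ (r k)))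
                     in proj₁ t , proj₂ (proj₂ t)
        go (no ¬r) = contradiction r ¬r

      σ-fire : ∀ k → Recurrent u (u k) → σ (suc k) (u k) ≡ 2
      σ-fire k r = gap refl (proj₂ (σ-till (suc k) (u k) r))

      σ-step : ∀ k → σ k ≐ step (u k) (σ (suc k))
      σ-step k a r with a Fin.≟ u k
      ... | yes refl = till-functional (proj₂ (σ-till k a r)) (here refl)
      ... | no a≢uk  = trans
        (till-functional (proj₂ (σ-till k a r)) (there (a≢uk ∘ sym) (proj₂ (σ-till (suc k) a r))))
                             (ℕ.+-comm (wt (u k) a) _)

      prefix : ℕ → List Color
      prefix zero    = []
      prefix (suc k) = u k ∷ prefix k

      -- Going up from the cut `k`, every recurrent letter fires at charge 2 by `gap`; the charges
      -- left over at the top are those before the first occurrences, which `dominant` bounds by 1.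
      legal : ∀ k → Legal (σ k) (prefix k)
      legal zero    a r = dominant (proj₂ (σ-till 0 a r))
      legal (suc k) = σ-fire k , legal-≐ (prefix k) (σ-step k) (legal k)

      -- `repetition` asks for the bound at all colors. For the transient ones it holds by the
      -- default value 0 in `charge`.
      σ≤2 : ∀ k a → σ k a ℕ.≤ 2
      σ≤2 k a = go (lem {Recurrent u a})
        where
        transient : ∀ (r? : Dec (Recurrent u a)) → ¬ Recurrent u a → charge k a r? ℕ.≤ 2
        transient (yes r) ¬r = contradiction r ¬r
        transient (no _)  _  = z≤n
        go : Dec (Recurrent u a) → σ k a ℕ.≤ 2
        go (yes r) = legal-bound (prefix k) r (legal k)
        go (no ¬r) = transient lem ¬r

      K : ℕ
      K = proj₁ (eventually-recurrent u)

      backwards : ℕ → ℕ → List Color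
      backwards k zero    = []
      backwards k (suc d) = u (d ℕ.+ k) ∷ backwards k d

      backwards-playable : ∀ {k} d → K ℕ.≤ k → ∀ {τ} → τ ≐ σ (d ℕ.+ k) →
                           Playable τ (backwards k d) × run τ (backwards k d) ≐ σ k
      backwards-playable zero K≤k τ≐σ = tt , τ≐σ
      backwards-playable {k} (suc d) K≤k τ≐σ =
        let j = d ℕ.+ k
            r = proj₂ (eventually-recurrent u) j (ℕ.≤-trans K≤k (ℕ.m≤n+m k d))
            pl , end = backwards-playable d K≤k (λ a ra → trans (step-≐ τ≐σ a ra) (sym (σ-step j a ra)))
        in ((r , trans (τ≐σ (u j) r) (σ-fire j r)) , pl) , end

    no-dominant-word : ⊥
    no-dominant-word =
      -- The shift by `K` puts both cuts where only recurrent letters follow, as `Playable` demands.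
      let i , j , i<j , same = repetition (λ k → σ (k ℕ.+ K)) (λ k → σ≤2 (k ℕ.+ K))
          s = i ℕ.+ K
          -- The loop has length `suc d`, which makes it visibly nonempty.
          d = j ℕ.∸ suc i
          t≡ : suc d ℕ.+ s ≡ j ℕ.+ K
          t≡ = trans (sym (ℕ.+-assoc (suc d) i K)) (cong (ℕ._+ K) (trans (sym (ℕ.+-suc d i)) (ℕ.m∸n+n≡m i<j)))
          same′ : σ s ≐ σ (suc d ℕ.+ s)
          same′ a _ = trans (same a) (cong (λ k → σ k a) (sym t≡))
          pl , end = backwards-playable {s} (suc d) (ℕ.m≤n+m K i) same′
      in no-loop (prefix s) (u (d ℕ.+ s)) (backwards s d) pl end (legal s)

  module _ {u : ℕ → Color} (heaped : IsHeaped u) (recurrent : ∀ a → Recurrent u a) where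
    open IsHeaped heaped

    private
      τ : ℕ → Color → ℕ
      τ zero    a = 0
      τ (suc k) = step (u k) (τ k)

      -- Weight collected plus weight to come is the full gap between two occurrences. The earlier
      -- occurrence at `i` is what makes this true: before it, `τ` counts from the arbitrary initial
      -- value 0.
      τ-till : ∀ k {i a m v} → i ℕ.< k → u i ≡ a → Till u a k m v → τ k a ℕ.+ v ≡ 2
      τ-till (suc k) {i} {a} {v = v} i<k ui≡a t with a Fin.≟ u k
      ... | yes a≡uk = gap (sym a≡uk) t
      ... | no  a≢uk = trans (ℕ.+-assoc (τ k a) (wt (u k) a) v)
        (τ-till k (ℕ.≤∧≢⇒< (ℕ.s≤s⁻¹ i<k) λ { refl → a≢uk (sym ui≡a) }) ui≡a (there (a≢uk ∘ sym) t))

      start : ∃[ K ] (∀ a → ∃[ i ] i ℕ.< K × u i ≡ a)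
      start =
        let N , ≤N = upperBound (λ a → proj₁ (recurrent a 0))
        in suc N , λ a → proj₁ (recurrent a 0) , s≤s (≤N a) , proj₂ (proj₂ (recurrent a 0))

      K : ℕ
      K = proj₁ start

      τ-ready : ∀ {k} → K ℕ.≤ k → τ k (u k) ≡ 2
      τ-ready {k} K≤k =
        let i , i<K , ui≡ = proj₂ start (u k)
        in trans (sym (ℕ.+-identityʳ _)) (τ-till k (ℕ.<-≤-trans i<K K≤k) ui≡ (here refl))

      τ≤2 : ∀ {k} → K ℕ.≤ k → ∀ a → τ k a ℕ.≤ 2
      τ≤2 {k} K≤k a =
        let i , i<K , ui≡ = proj₂ start a
            j , k≤j , uj≡ = recurrent a k
            m , v , t     = till-exists {u} {a} k≤j uj≡
        in ℕ.m+n≤o⇒m≤o _ (ℕ.≤-reflexive (τ-till k (ℕ.<-≤-trans i<K K≤k) ui≡ t))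

      window : ∀ k → ∃[ k′ ] k ℕ.< k′ × (∀ a → ∃[ j ] k ℕ.≤ j × j ℕ.< k′ × u j ≡ a)
      window k =
        let N , ≤N = upperBound (λ a → proj₁ (recurrent a k))
        in suc (k ℕ.⊔ N) , s≤s (ℕ.m≤m⊔n k N) , λ a →
             let j , k≤j , uj≡ = recurrent a k
             in j , k≤j , s≤s (ℕ.≤-trans (≤N a) (ℕ.m≤n⊔m k N)) , uj≡

      -- States are compared only at the ends of windows that contain every color. Hence the period
      -- between two equal states contains every color as well, which is where `sooner` comes from.
      g : ℕ → ℕ
      g zero    = K
      g (suc i) = proj₁ (window (g i))

      g-step : ∀ i → g i ℕ.< g (suc i)
      g-step i = proj₁ (proj₂ (window (g i)))

      K≤g : ∀ i → K ℕ.≤ g i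
      K≤g zero    = ℕ.≤-refl
      K≤g (suc i) = ℕ.≤-trans (K≤g i) (ℕ.<⇒≤ (g-step i))

      g-mono : ∀ {i} d → g i ℕ.≤ g (d ℕ.+ i)
      g-mono zero    = ℕ.≤-refl
      g-mono (suc d) = ℕ.≤-trans (g-mono d) (ℕ.<⇒≤ (g-step _))

      period : ∃₂ λ s L → K ℕ.≤ s × (∀ a → τ s a ≡ τ (s ℕ.+ suc L) a)
                        × (∀ a → ∃[ r ] r ℕ.≤ L × u (s ℕ.+ r) ≡ a)
      period =
        let i , j , i<j , same = repetition (τ ∘ g) (λ k → τ≤2 (K≤g k))
            s = g i
            g[1+i]≤gj = subst (λ l → g (suc i) ℕ.≤ g l) (ℕ.m∸n+n≡m i<j) (g-mono (j ℕ.∸ suc i))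
            s<gj = ℕ.≤-trans (g-step i) g[1+i]≤gj
            L = g j ℕ.∸ suc s
            t≡ : s ℕ.+ suc L ≡ g j
            t≡ = trans (ℕ.+-suc s L) (ℕ.m+[n∸m]≡n s<gj)
        in s , L , K≤g i , (λ a → trans (same a) (cong (λ k → τ k a) (sym t≡))) , λ a →
          let l , s≤l , l<k′ , ul≡ = proj₂ (proj₂ (window s)) a
          in l ℕ.∸ s ,
             ℕ.s≤s⁻¹ (ℕ.+-cancelˡ-< s _ _ (subst (ℕ._< s ℕ.+ suc L) (sym (ℕ.m+[n∸m]≡n s≤l))
                (subst (l ℕ.<_) (sym t≡) (ℕ.<-≤-trans l<k′ g[1+i]≤gj)))) ,
             trans (cong u (ℕ.m+[n∸m]≡n s≤l)) ul≡

      s L : ℕ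
      s = proj₁ period
      L = proj₁ (proj₂ period)

      -- Position -[1+ m ] carries the letter s + phase m: the negative part
      -- of the word repeats the letters s, …, s + L.
      previous : ℕ → ℕ
      previous zero    = L
      previous (suc r) = r

      phase : ℕ → ℕ
      phase zero    = L
      phase (suc m) = previous (phase m)

      phase-descend : ∀ m d r → phase m ≡ d ℕ.+ r → phase (d ℕ.+ m) ≡ r
      phase-descend m zero    r eq = eq
      phase-descend m (suc d) r eq = cong previous (phase-descend m d (suc r) (trans eq (sym (ℕ.+-suc d r))))

      -- Descend to phase 0, wrap around to phase `L` one step later, and descend `L ∸ r` further.
      phase-reach : ∀ m {r} → r ℕ.≤ L → ∃[ m′ ] m ℕ.≤ m′ × phase m′ ≡ r
      phase-reach m {r} r≤L =
        let x  = phase m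
            m₁ = suc (x ℕ.+ m)
            d  = L ℕ.∸ r
            top = cong previous (phase-descend m x 0 (sym (ℕ.+-identityʳ x)))
        in d ℕ.+ m₁ , ℕ.≤-trans (ℕ.m≤n+m m x) (ℕ.≤-trans (ℕ.n≤1+n _) (ℕ.m≤n+m m₁ d)) ,
           phase-descend m₁ d r (trans top (sym (ℕ.m∸n+n≡m r≤L)))

      index : ℤ → ℕ
      index (+ k)    = s ℕ.+ k
      index -[1+ m ] = s ℕ.+ phase m

      K≤index : ∀ i → K ℕ.≤ index i
      K≤index (+ k)    = ℕ.≤-trans (proj₁ (proj₂ (proj₂ period))) (ℕ.m≤m+n s k)
      K≤index -[1+ m ] = ℕ.≤-trans (proj₁ (proj₂ (proj₂ period))) (ℕ.m≤m+n s (phase m))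

      wrap : ∀ a → τ s a ≡ τ (s ℕ.+ suc L) a
      wrap = proj₁ (proj₂ (proj₂ (proj₂ period)))

      -- The index grows by one except where a period ends: there it is `s` instead of `s + suc L`,
      -- and these two indices have equal states.
      index-step : ∀ i a → τ (index (ℤ.suc i)) a ≡ τ (suc (index i)) a
      index-step (+ k)        a = cong (λ l → τ l a) (ℕ.+-suc s k)
      index-step -[1+ zero ]  a = trans (cong (λ l → τ l a) (ℕ.+-identityʳ s))
                                    (trans (wrap a) (cong (λ l → τ l a) (ℕ.+-suc s L)))
      index-step -[1+ suc m ] a with phase m
      ... | zero  = trans (cong (λ l → τ l a) (ℕ.+-identityʳ s))
                      (trans (wrap a) (cong (λ l → τ l a) (ℕ.+-suc s L)))
      ... | suc r = cong (λ l → τ l a) (ℕ.+-suc s r)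

      +-later : ∀ k a → ∃[ j ] k ℕ.< j × u (s ℕ.+ j) ≡ a
      +-later k a =
        let l , sk<l , ul≡ = recurrent a (s ℕ.+ suc k)
            s≤l = ℕ.≤-trans (ℕ.m≤m+n s (suc k)) sk<l
        in l ℕ.∸ s , ℕ.+-cancelˡ-≤ s _ _ (subst (s ℕ.+ suc k ℕ.≤_) (sym (ℕ.m+[n∸m]≡n s≤l)) sk<l) ,
           trans (cong u (ℕ.m+[n∸m]≡n s≤l)) ul≡

      -sooner : ∀ m a → ∃[ m′ ] m ℕ.< m′ × u (s ℕ.+ phase m′) ≡ a
      -sooner m a =
        let r , r≤L , ur≡ = proj₂ (proj₂ (proj₂ (proj₂ period))) a
            m′ , m<m′ , eq = phase-reach (suc m) r≤L
        in m′ , m<m′ , trans (cong (λ p → u (s ℕ.+ p)) eq) ur≡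

    extension : ∃₂ λ t (w : BiInfiniteWord) → ∀ k → BiInfiniteWord.letter w (+ k) ≡ u (t ℕ.+ k)
    extension = s , record
      { letter      = u ∘ index
      ; charge      = τ ∘ index
      ; charge-step = index-step
      ; ready       = λ i → τ-ready (K≤index i)
      ; later       = later
      ; sooner      = sooner
      } , λ _ → refl
      where
      later : ∀ i a → ∃[ j ] i ℤ.< j × u (index j) ≡ a
      later (+ k)    a = let j , k<j , eq = +-later k a in + j , +<+ k<j , eq
      later -[1+ m ] a = let j , _ , eq = +-later 0 a in + j , -<+ , eq
      sooner : ∀ i a → ∃[ j ] j ℤ.< i × u (index j) ≡ a
      sooner (+ k)    a = let m , _ , eq = -sooner 0 a in -[1+ m ] , -<+ , eq
      sooner -[1+ m ] a = let m′ , m<m′ , eq = -sooner m a in -[1+ m′ ] , -<- m<m′ , eq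

-- Posets with the consecutive-element condition

module HeapLike {Γ : DynkinDiagram} {c ℓ₁ ℓ₂ : Level} (P : ColoredPoset Γ c ℓ₁ ℓ₂)
                (_≤?_ : Decidable (ColoredPoset._≤ᴾ_ P)) (heapLike : IsHeapLike P) where
  open DynkinDiagram Γ
  open Weights Γ
  open ColoredPoset P
  open Poset poset using (module Eq; antisym)
    renaming (refl to ≤-refl; trans to ≤-trans; reflexive to ≤-reflexive)
  open IsHeapLike heapLike
  open PosetProperties poset using (<-trans; <-irrefl; <-respˡ-≈; <-respʳ-≈)
  open Membership Eq.setoid using (_∈_; _∉_)
  open FinitePoset poset _≤?_ public
  open Summation Eq.setoid

  κ-cong : ∀ {x y} → x ≈ y → κ x ≡ κ y
  κ-cong = Surjection.cong coloring

  weight : Color → Carrier → ℤ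
  weight a z = ℤ.- θ (κ z) a

  weight-cong : ∀ {a} → Congruent (weight a)
  weight-cong {a} x≈y = cong (λ b → ℤ.- θ b a) (κ-cong x≈y)

  interval : ∀ x y → List Carrier
  interval x y = proj₁ (locallyFinite x y)

  ∈-interval : ∀ {x y z} → x ≤ᴾ z → z ≤ᴾ y → z ∈ interval x y
  ∈-interval {x} {y} {z} x≤z z≤y = Equivalence.from (proj₂ (proj₂ (locallyFinite x y)) z) (x≤z , z≤y)

  climb : ∀ y x → Acc (Climb y) x
  climb y = climb-wf (λ x → interval x y , λ v x≤v v≤y → ∈-interval x≤v v≤y)

  linked-compare : ∀ {x y} → Linked (κ x) (κ y) → x <ᴾ y ⊎ y ≤ᴾ x
  linked-compare {x} {y} l with y ≤? x
  ... | yes y≤x = inj₂ y≤x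
  ... | no y≰x with linked-comparable x y l
  ...   | inj₁ x≤y = inj₁ (x≤y , y≰x ∘ ≤-reflexive ∘ Eq.sym)
  ...   | inj₂ y≤x = contradiction y≤x y≰x

  first-above : ∀ {a x y} → x <ᴾ y → κ y ≡ a →
                ∃[ z ] x <ᴾ z × κ z ≡ a × z ≤ᴾ y × (∀ v → x <ᴾ v → v <ᴾ z → κ v ≢ a)
  first-above {a} {x} {y} x<y κy≡a =
    let z , (x<z , κz≡a) , z≤y , min = minimal {R = λ v → x <ᴾ v × κ v ≡ a}
          (λ v → (x <? v) ×-dec (κ v Fin.≟ a))
          (λ v≈w (x<v , κv≡a) → <-respʳ-≈ v≈w x<v , trans (sym (κ-cong v≈w)) κv≡a)
          (interval x y) (x<y , κy≡a) (λ v v<y (x<v , _) → ∈-interval (proj₁ x<v) (proj₁ v<y))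
    in z , x<z , κz≡a , z≤y , λ v x<v v<z κv≡a → min v v<z (x<v , κv≡a)

  next : ∀ {a x y} → κ x ≡ a → κ y ≡ a → x <ᴾ y → ∃[ z ] Consecutive a x z × z ≤ᴾ y
  next {a} {x} {y} κx≡a κy≡a x<y =
    let z , x<z , κz≡a , z≤y , min = first-above x<y κy≡a
    in z , (x<z , κx≡a , κz≡a , λ v (x<v , v<z) → min v x<v v<z) , z≤y

  last-below : ∀ {a x y} → x <ᴾ y → κ x ≡ a →
               ∃[ z ] z <ᴾ y × κ z ≡ a × x ≤ᴾ z × (∀ v → z <ᴾ v → v <ᴾ y → κ v ≢ a)
  last-below {a} {x} {y} x<y κx≡a =
    let z , (z<y , κz≡a) , x≤z , min = Dual.minimal {R = λ v → v <ᴾ y × κ v ≡ a}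
          (λ v → (v <? y) ×-dec (κ v Fin.≟ a))
          (λ v≈w (v<y , κv≡a) → <-respˡ-≈ v≈w v<y , trans (sym (κ-cong v≈w)) κv≡a)
          (interval x y) (x<y , κx≡a) (λ v x<v (v<y , _) → ∈-interval (proj₁ x<v) (proj₁ v<y))
    in z , z<y , κz≡a , x≤z , λ v z<v v<y κv≡a → min v (dual-<⁻ P z<v) (v<y , κv≡a)
    where module Dual = FinitePoset (PosetProperties.≥-poset poset) (flip _≤?_)

  prev : ∀ {a x y} → κ x ≡ a → κ y ≡ a → x <ᴾ y → ∃[ z ] Consecutive a z y × x ≤ᴾ z
  prev {a} {x} {y} κx≡a κy≡a x<y =
    let z , z<y , κz≡a , x≤z , max = last-below x<y κx≡a
    in z , (z<y , κz≡a , κy≡a , λ v (z<v , v<y) → max v z<v v<y) , x≤z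

  consecutive-uniqueʳ : ∀ {a b x y x′ y′} → Consecutive a x y → Consecutive b x′ y′ → x ≈ x′ → y ≈ y′
  consecutive-uniqueʳ {x = x} {y} {x′} {y′} (x<y , κx≡a , κy≡a , gap) (x′<y′ , κx′≡b , κy′≡b , gap′) x≈x′ =
    [ (λ y<y′ → contradiction (trans κy≡a a≡b) (gap′ y (<-respˡ-≈ x≈x′ x<y , y<y′)))
    , (λ y′≤y → decidable-stable (y ≈? y′) λ y≉y′ →
        gap y′ (<-respˡ-≈ (Eq.sym x≈x′) x′<y′ , (y′≤y , y≉y′ ∘ Eq.sym)) (trans κy′≡b (sym a≡b)))
    ]′ (linked-compare (inj₁ (trans κy≡a (trans a≡b (sym κy′≡b)))))
    where
    a≡b = trans (sym κx≡a) (trans (κ-cong x≈x′) κx′≡b)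

  consecutive-uniqueˡ : ∀ {a b x y x′ y′} → Consecutive a x y → Consecutive b x′ y′ → y ≈ y′ → x ≈ x′
  consecutive-uniqueˡ {x = x} {y} {x′} {y′} (x<y , κx≡a , κy≡a , gap) (x′<y′ , κx′≡b , κy′≡b , gap′) y≈y′ =
    [ (λ x<x′ → contradiction (trans κx′≡b (sym a≡b)) (gap x′ (x<x′ , <-respʳ-≈ (Eq.sym y≈y′) x′<y′)))
    , (λ x′≤x → decidable-stable (x ≈? x′) λ x≉x′ →
        gap′ x ((x′≤x , x≉x′ ∘ Eq.sym) , <-respʳ-≈ y≈y′ x<y) (trans κx≡a a≡b))
    ]′ (linked-compare (inj₁ (trans κx≡a (trans a≡b (sym κx′≡b)))))
    where
    a≡b = trans (sym κy≡a) (trans (κ-cong y≈y′) κy′≡b)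

  cover-above : ∀ {x y} → x <ᴾ y → ∃[ z ] x ⋖ z × z ≤ᴾ y
  cover-above {x} {y} x<y =
    let z , x<z , z≤y , min = minimal {R = x <ᴾ_} (x <?_) <-respʳ-≈ (interval x y) x<y
          (λ v v<y x<v → ∈-interval (proj₁ x<v) (proj₁ v<y))
    in z , (x<z , λ { (v , x<v , v<z) → min v v<z x<v }) , z≤y

  -- The two ends contribute `θ a a` each, and 2 + 2 - 2 = 2: this turns ICE2 into G5.
  consecutive-closed : ∀ {a x y} → Consecutive a x y → HasSum [ x , y ] (λ z → θ (κ z) a) (+ 2)
  consecutive-closed {a} {x} {y} con@(x<y , refl , κy≡a , _) =
    let xs , (u , e) , s = ice con
        y∉xs = λ y∈ → <-irrefl Eq.refl (proj₂ (Equivalence.to (e y) y∈))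
        x∉ys = λ { (here x≈y) → <-irrefl x≈y x<y
                   ; (there x∈) → <-irrefl Eq.refl (proj₁ (Equivalence.to (e x) x∈)) }
    in x ∷ y ∷ xs , (unique-∷ x∉ys (unique-∷ y∉xs u) , λ z → mk⇔
         (λ { (here z≈x)         → ≤-reflexive (Eq.sym z≈x) , ≤-trans (≤-reflexive z≈x) (proj₁ x<y)
            ; (there (here z≈y)) → ≤-trans (proj₁ x<y) (≤-reflexive (Eq.sym z≈y)) , ≤-reflexive z≈y
            ; (there (there z∈)) → Product.map proj₁ proj₁ (Equivalence.to (e z) z∈) })
         (λ { (x≤z , z≤y) → place e (z ≈? x) (z ≈? y) x≤z z≤y })) ,
       trans (cong₂ (λ i j → i ℤ.+ (j ℤ.+ sum (λ z → θ (κ z) a) xs)) (θ-diag a)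
               (trans (cong (λ b → θ b a) κy≡a) (θ-diag a)))
             (cong (λ i → + 2 ℤ.+ (+ 2 ℤ.+ i)) (trans (negate xs) (cong ℤ.-_ s)))
    where
    negate : ∀ xs → sum (λ z → θ (κ z) a) xs ≡ ℤ.- sum (weight a) xs
    negate []       = refl
    negate (z ∷ zs) = trans (cong₂ ℤ._+_ (sym (ℤ.neg-involutive (θ (κ z) a))) (negate zs))
                            (sym (ℤ.neg-distrib-+ (weight a z) (sum (weight a) zs)))
    place : ∀ {z xs} → (∀ z → z ∈ xs ⇔ ⦅ x , y ⦆ z) → Dec (z ≈ x) → Dec (z ≈ y) →
            x ≤ᴾ z → z ≤ᴾ y → z ∈ (x ∷ y ∷ xs)
    place e (yes z≈x) _ _ _ = here z≈x
    place e (no _) (yes z≈y) _ _ = there (here z≈y)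
    place {z} e (no z≉x) (no z≉y) x≤z z≤y =
      there (there (Equivalence.from (e z) ((x≤z , z≉x ∘ Eq.sym) , (z≤y , z≉y))))

  -- Each element of a color adjacent to `a` weighs at least 1, and the total is 2. The chain
  -- ensures that the three elements are distinct. This bound is what yields G4.
  at-most-two : ∀ {a x y} → Consecutive a x y → ∀ {z₁ z₂ z₃} → z₁ <ᴾ z₂ → z₂ <ᴾ z₃ →
                ¬ (∀ {z} → z ≈ z₁ ⊎ z ≈ z₂ ⊎ z ≈ z₃ → ⦅ x , y ⦆ z × κ z ∼ a)
  at-most-two {a} {x} {y} con {z₁} {z₂} {z₃} z₁<z₂ z₂<z₃ inside =
    let xs , (u , e) , s = ice con
        three = z₁ ∷ z₂ ∷ z₃ ∷ []
        three! = unique-∷ (λ { (here eq)         → <-irrefl eq z₁<z₂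
                             ; (there (here eq)) → <-irrefl eq (<-trans z₁<z₂ z₂<z₃)
                             ; (there (there ())) })
                  (unique-∷ (λ { (here eq) → <-irrefl eq z₂<z₃ ; (there ()) }) (unique-∷ (λ ()) []))
        bound = sum-mono {f = weight a} weight-cong {three} {xs}
          (λ {z} z∈ → nonneg (proj₂ (proj₂ (proj₂ con)) z (Equivalence.to (e z) z∈))) three!
          (λ {z} _ z∈ → Equivalence.from (e z) (proj₁ (inside (which z∈))))
        big = ℤ.+-mono-≤ (positive (inj₁ Eq.refl)) (ℤ.+-mono-≤ (positive (inj₂ (inj₁ Eq.refl)))
                (ℤ.+-mono-≤ (positive (inj₂ (inj₂ Eq.refl))) (ℤ.≤-refl {0ℤ})))
    in contradiction (ℤ.≤-trans big (subst (sum (weight a) three ℤ.≤_) s bound)) λ { (+≤+ (s≤s (s≤s ()))) }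
    where
    which : ∀ {z} → z ∈ (z₁ ∷ z₂ ∷ z₃ ∷ []) → z ≈ z₁ ⊎ z ≈ z₂ ⊎ z ≈ z₃
    which (here eq) = inj₁ eq
    which (there (here eq)) = inj₂ (inj₁ eq)
    which (there (there (here eq))) = inj₂ (inj₂ eq)
    nonneg : ∀ {z} → κ z ≢ a → 0ℤ ℤ.≤ weight a z
    nonneg κz≢a = subst (0ℤ ℤ.≤_) (sym (-θ≡wt κz≢a)) (+≤+ z≤n)
    positive : ∀ {z} → z ≈ z₁ ⊎ z ≈ z₂ ⊎ z ≈ z₃ → 1ℤ ℤ.≤ weight a z
    positive z≈ = let κz∼a = proj₂ (inside z≈)
                  in subst (1ℤ ℤ.≤_) (sym (-θ≡wt (proj₁ κz∼a))) (+≤+ (∼⇒wt>0 κz∼a))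

-- The heap of a bi-infinite word

suc+ : ∀ i k → ℤ.suc (i ℤ.+ + k) ≡ i ℤ.+ + suc k
suc+ i k = begin
  1ℤ ℤ.+ (i ℤ.+ + k) ≡⟨ ℤ.+-assoc 1ℤ i (+ k) ⟨
  1ℤ ℤ.+ i ℤ.+ + k   ≡⟨ cong (ℤ._+ + k) (ℤ.+-comm 1ℤ i) ⟩
  i ℤ.+ 1ℤ ℤ.+ + k   ≡⟨ ℤ.+-assoc i 1ℤ (+ k) ⟩
  i ℤ.+ + suc k      ∎
  where open ≡-Reasoning

+suc : ∀ i k → i ℤ.+ + suc k ≡ ℤ.suc i ℤ.+ + k
+suc i k = trans (sym (suc+ i k)) (sym (ℤ.+-assoc 1ℤ i (+ k)))

i<suc : ∀ i → i ℤ.< ℤ.suc i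
i<suc i = ℤ.suc[i]≤j⇒i<j ℤ.≤-refl

suc-cancel-≤ : ∀ {i j} → ℤ.suc i ℤ.≤ ℤ.suc j → i ℤ.≤ j
suc-cancel-≤ {i} {j} le = subst₂ ℤ._≤_ (ℤ.pred-suc i) (ℤ.pred-suc j) (ℤ.pred-mono le)

≤⇒offset : ∀ {i j} → i ℤ.≤ j → ∃[ k ] j ≡ i ℤ.+ + k
≤⇒offset {i} {j} i≤j = ℤ.∣ j ℤ.- i ∣ , (begin
  j                         ≡⟨ ℤ.+-identityˡ j ⟨
  0ℤ ℤ.+ j                  ≡⟨ cong (ℤ._+ j) (ℤ.+-inverseʳ i) ⟨
  i ℤ.- i ℤ.+ j             ≡⟨ ℤ.+-assoc i (ℤ.- i) j ⟩
  i ℤ.+ (ℤ.- i ℤ.+ j)       ≡⟨ cong (λ n → i ℤ.+ n) (ℤ.+-comm (ℤ.- i) j) ⟩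
  i ℤ.+ (j ℤ.- i)           ≡⟨ cong (λ n → i ℤ.+ n) (ℤ.0≤i⇒+∣i∣≡i (ℤ.i≤j⇒0≤j-i i≤j)) ⟨
  i ℤ.+ + ℤ.∣ j ℤ.- i ∣     ∎)
  where open ≡-Reasoning

i≤i+ : ∀ i k → i ℤ.≤ i ℤ.+ + k
i≤i+ i k = ℤ.i≤i+j i (+ k)

module WordHeap (lem : ExcludedMiddle 0ℓ) (Γ : DynkinDiagram)
                (biword : Firing.BiInfiniteWord Γ) (c ℓ₁ ℓ₂ : Level) where
  open DynkinDiagram Γ
  open Weights Γ
  open Firing Γ
  open BiInfiniteWord biword

  -- The closure `Path` of these steps is the order of Viennot's heap of the word: only letters that
  -- do not commute keep their order.
  Edge : Rel ℤ 0ℓ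
  Edge i j = i ℤ.< j × Linked (letter i) (letter j)

  Path : Rel ℤ 0ℓ
  Path = Star Edge

  path⇒≤ : ∀ {i j} → Path i j → i ℤ.≤ j
  path⇒≤ ε             = ℤ.≤-refl
  path⇒≤ ((i<k , _) ◅ p) = ℤ.≤-trans (ℤ.<⇒≤ i<k) (path⇒≤ p)

  last-edge : ∀ {i j} → Path i j → i ≢ j → ∃[ k ] Path i k × Edge k j
  last-edge ε i≢i = contradiction refl i≢i
  last-edge {i} {j} (_◅_ {j = k} e p) i≢j with k ℤ.≟ j
  ... | yes refl = i , ε , e
  ... | no k≢j   = let l , q , e′ = last-edge p k≢j in l , e ◅ q , e′

  first-edge : ∀ {i j} → Path i j → i ≢ j → ∃[ k ] Edge i k × Path k j
  first-edge ε i≢i       = contradiction refl i≢i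
  first-edge (e ◅ p) i≢j = _ , e , p

  -- The lifting brings ℤ to the levels of `P`, since `IsFilterOf` relates posets of the same
  -- levels.
  heapPoset : Poset c ℓ₁ ℓ₂
  heapPoset = record
    { Carrier = Lift c ℤ
    ; _≈_     = λ x y → Lift ℓ₁ (lower x ≡ lower y)
    ; _≤_     = λ x y → Lift ℓ₂ (Path (lower x) (lower y))
    ; isPartialOrder = record
      { isPreorder = record
        { isEquivalence = record
          { refl  = lift refl
          ; sym   = λ (lift e) → lift (sym e)
          ; trans = λ (lift e) (lift f) → lift (trans e f)
          }
        ; reflexive = λ { {lift i} {lift .i} (lift refl) → lift ε }
        ; trans     = λ (lift p) (lift q) → lift (p ◅◅ q)
        }
      ; antisym = λ (lift p) (lift q) → lift (ℤ.≤-antisym (path⇒≤ p) (path⇒≤ q))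
      }
    }

  open Poset heapPoset using (Carrier; _≈_; _≤_; module Eq)
  open PosetProperties heapPoset using (_<_; <-irrefl)
  open PosetNotions heapPoset using (HasSum; ⦅_,_⦆; LocallyFinite)

  _≤?_ : Decidable _≤_
  x ≤? y = map′ lift lower lem

  open FinitePoset heapPoset _≤?_ using (_<?_; enumerate)
  open Membership Eq.setoid using (_∈_)
  open UniqueSetoid Eq.setoid using (Unique)
  open Summation Eq.setoid using (sum; sum-agree; unique-∷; Congruent)

  <⇒ℤ< : ∀ {x y} → x < y → lower x ℤ.< lower y
  <⇒ℤ< (lift p , x≉y) = ℤ.≤∧≢⇒< (path⇒≤ p) (x≉y ∘ lift)

  ℤ<∧path⇒< : ∀ {x y} → lower x ℤ.< lower y → Path (lower x) (lower y) → x < y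
  ℤ<∧path⇒< i<j p = lift p , λ (lift e) → ℤ.<⇒≢ i<j e

  edge⇒< : ∀ {i j} → Edge i j → lift i < lift j
  edge⇒< e = ℤ<∧path⇒< (proj₁ e) (e ◅ ε)

  range : ℤ → ℕ → List Carrier
  range i zero    = []
  range i (suc m) = lift i ∷ range (ℤ.suc i) m

  ∈-range⁺ : ∀ i m {z} → i ℤ.≤ lower z → lower z ℤ.< i ℤ.+ + m → z ∈ range i m
  ∈-range⁺ i zero    i≤z z< = contradiction i≤z (ℤ.<⇒≱ (subst (_ ℤ.<_) (ℤ.+-identityʳ i) z<))
  ∈-range⁺ i (suc m) {z} i≤z z< with lower z ℤ.≟ i
  ... | yes z≡i = here (lift z≡i)
  ... | no  z≢i = there (∈-range⁺ (ℤ.suc i) m (ℤ.i<j⇒suc[i]≤j (ℤ.≤∧≢⇒< i≤z (z≢i ∘ sym)))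
                         (subst (lower z ℤ.<_) (+suc i m) z<))

  ∈-range⁻ : ∀ i m {z} → z ∈ range i m → i ℤ.≤ lower z × lower z ℤ.< i ℤ.+ + m
  ∈-range⁻ i (suc m) (here (lift z≡i)) rewrite z≡i =
    ℤ.≤-refl , subst (i ℤ.<_) (sym (+suc i m)) (ℤ.<-≤-trans (i<suc i) (i≤i+ (ℤ.suc i) m))
  ∈-range⁻ i (suc m) {z} (there z∈) =
    let i<z , z< = ∈-range⁻ (ℤ.suc i) m z∈
    in ℤ.≤-trans (ℤ.<⇒≤ (i<suc i)) i<z , subst (lower z ℤ.<_) (sym (+suc i m)) z<

  range-unique : ∀ i m → Unique (range i m)
  range-unique i zero    = []
  range-unique i (suc m) = unique-∷
    (λ i∈ → ℤ.<⇒≱ (i<suc i) (proj₁ (∈-range⁻ (ℤ.suc i) m i∈))) (range-unique (ℤ.suc i) m)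

  locallyFinite : LocallyFinite
  locallyFinite x y = enumerate {R = λ z → x ≤ z × z ≤ y} (λ z → (x ≤? z) ×-dec (z ≤? y))
    (λ { {lift i} {lift .i} (lift refl) → id })
    (range (lower x) ℤ.∣ ℤ.suc (lower y) ℤ.- lower x ∣)
    λ z (lift p , lift q) →
      let x≤z = path⇒≤ p
          z<1+y = ℤ.≤-<-trans (path⇒≤ q) (i<suc (lower y))
          _ , eq = ≤⇒offset (ℤ.≤-trans x≤z (ℤ.<⇒≤ z<1+y))
      in ∈-range⁺ _ _ x≤z (subst (lower z ℤ.<_) eq z<1+y)

  heap : ColoredPoset Γ c ℓ₁ ℓ₂
  heap = record
    { poset         = heapPoset
    ; locallyFinite = locallyFinite
    ; coloring      = record
      { to         = letter ∘ lower
      ; cong       = λ (lift e) → cong letter e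
      ; surjective = λ a → let i , _ , eq = later 0ℤ a in lift i , λ (lift e) → trans (cong letter e) eq
      }
    }

  open ColoredPoset heap using (κ; Comparable; Consecutive; OfColor; Neighbors; Connected; _<ᴾ_)

  weight : Color → Carrier → ℤ
  weight a z = ℤ.- θ (κ z) a

  linked-comparable : ∀ x y → Linked (κ x) (κ y) → Comparable x y
  linked-comparable (lift i) (lift j) l with ℤ.<-cmp i j
  ... | tri< i<j _ _  = inj₁ (lift ((i<j , l) ◅ ε))
  ... | tri≈ _ refl _ = inj₁ (lift ε)
  ... | tri> _ _ j<i  = inj₂ (lift ((j<i , Linked-sym l) ◅ ε))

  -- The charge of `a` is not reset as long as `a` is not read, so `charge-step` telescopes.
  range-sum : ∀ {a} i m → (∀ j → i ℤ.≤ j → j ℤ.< i ℤ.+ + m → letter j ≢ a) →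
              + charge i a ℤ.+ sum (weight a) (range i m) ≡ + charge (i ℤ.+ + m) a
  range-sum {a} i zero    free = trans (ℤ.+-identityʳ _) (cong (λ j → + charge j a) (sym (ℤ.+-identityʳ i)))
  range-sum {a} i (suc m) free = begin
    + charge i a ℤ.+ (weight a (lift i) ℤ.+ rest)     ≡⟨ ℤ.+-assoc (+ charge i a) (weight a (lift i)) rest ⟨
    + charge i a ℤ.+ weight a (lift i) ℤ.+ rest       ≡⟨ cong (λ w → + charge i a ℤ.+ w ℤ.+ rest) (-θ≡wt i≢a) ⟩
    + (charge i a ℕ.+ wt (letter i) a) ℤ.+ rest       ≡⟨ cong (λ k → + k ℤ.+ rest) charge-suc ⟨
    + charge (ℤ.suc i) a ℤ.+ rest                     ≡⟨ range-sum (ℤ.suc i) m free-rest ⟩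
    + charge (ℤ.suc i ℤ.+ + m) a                      ≡⟨ cong (λ j → + charge j a) (+suc i m) ⟨
    + charge (i ℤ.+ + suc m) a                        ∎
    where
    open ≡-Reasoning
    rest : ℤ
    rest = sum (weight a) (range (ℤ.suc i) m)
    i≢a : letter i ≢ a
    i≢a = free i ℤ.≤-refl (subst (i ℤ.<_) (sym (+suc i m)) (ℤ.<-≤-trans (i<suc i) (i≤i+ (ℤ.suc i) m)))
    charge-suc : charge (ℤ.suc i) a ≡ charge i a ℕ.+ wt (letter i) a
    charge-suc = trans (charge-step i a) (step-miss {letter i} {charge i} (i≢a ∘ sym))
    free-rest : ∀ j → ℤ.suc i ℤ.≤ j → j ℤ.< ℤ.suc i ℤ.+ + m → letter j ≢ a
    free-rest j i<j j< =
      free j (ℤ.≤-trans (ℤ.<⇒≤ (i<suc i)) i<j) (subst (j ℤ.<_) (sym (+suc i m)) j<)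

  -- The charge of `a` is 0 right after the position of `x` and 2 at that of `y`, and the letters in
  -- between supply the difference. Those of nonzero weight are linked to both ends, hence lie in
  -- the interval.
  ice : ∀ {a x y} → Consecutive a x y → HasSum ⦅ x , y ⦆ (weight a) (+ 2)
  ice {a} {x} {y} (x<y , κx≡a , κy≡a , gap) =
    let m , eq = ≤⇒offset (ℤ.i<j⇒suc[i]≤j (<⇒ℤ< x<y))
        covers = λ z (x<z , z<y) → ∈-range⁺ (ℤ.suc i) m
          (ℤ.i<j⇒suc[i]≤j (<⇒ℤ< x<z)) (subst (lower z ℤ.<_) eq (<⇒ℤ< z<y))
        xs , u , e = enumerate {R = ⦅ x , y ⦆} (λ z → (x <? z) ×-dec (z <? y))
          (λ { {lift i} {lift .i} (lift refl) → id }) (range (ℤ.suc i) m) covers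
        free = λ k i<k k<j letterk≡a → gap (lift k)
          ( edge⇒< (ℤ.suc[i]≤j⇒i<j i<k , inj₁ (trans κx≡a (sym letterk≡a)))
          , edge⇒< (subst (k ℤ.<_) (sym eq) k<j , inj₁ (trans letterk≡a (sym κy≡a)))) letterk≡a
        linked-in = λ {z} (z∈ : z ∈ range (ℤ.suc i) m) (w≢0 : weight a z ≢ 0ℤ) →
          let i<z , z<j = ∈-range⁻ (ℤ.suc i) m z∈
              z∼a = θ≢0⇒∼ (free (lower z) i<z z<j) (-θ≢0⇒θ≢0 w≢0)
          in edge⇒< (ℤ.suc[i]≤j⇒i<j i<z , Linked-sym (inj₂ (subst (κ z ∼_) (sym κx≡a) z∼a))) ,
             edge⇒< (subst (lower z ℤ.<_) (sym eq) z<j , inj₂ (subst (κ z ∼_) (sym κy≡a) z∼a))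
    in xs , (u , e) , (begin
         sum (weight a) xs
           ≡⟨ sum-agree {weight a} (λ (lift e) → cong (λ k → weight a (lift k)) e)
                u (range-unique (ℤ.suc i) m)
                (λ {z} _ z∈ → covers z (Equivalence.to (e z) z∈))
                (λ {z} w≢0 z∈ → Equivalence.from (e z) (linked-in z∈ w≢0)) ⟩
         sum (weight a) (range (ℤ.suc i) m)
           ≡⟨ ℤ.+-identityˡ _ ⟨
         + 0 ℤ.+ sum (weight a) (range (ℤ.suc i) m)
           ≡⟨ cong (λ k → + k ℤ.+ sum (weight a) (range (ℤ.suc i) m))
                (trans (charge-step i a) (step-hit {letter i} {charge i} (sym κx≡a))) ⟨
         + charge (ℤ.suc i) a ℤ.+ sum (weight a) (range (ℤ.suc i) m)
           ≡⟨ range-sum (ℤ.suc i) m free ⟩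
         + charge (ℤ.suc i ℤ.+ + m) a
           ≡⟨ cong (λ k → + charge k a) eq ⟨
         + charge j a
           ≡⟨ cong (λ b → + charge j b) κy≡a ⟨
         + charge j (letter j)
           ≡⟨ cong +_ (ready j) ⟩
         + 2 ∎)
    where
    open ≡-Reasoning
    i j : ℤ
    i = lower x
    j = lower y

  heap-heapLike : IsHeapLike heap
  heap-heapLike = record { linked-comparable = linked-comparable ; ice = ice }

  open HeapLike heap _≤?_ heap-heapLike using (first-above; prev; linked-compare; consecutive-closed; at-most-two)

  linked⇒< : ∀ {x y} → lower x ℤ.< lower y → Linked (κ x) (κ y) → x < y
  linked⇒< i<j l = edge⇒< (i<j , l)

  -- Let `y′` and `y` be the consecutive elements of color `b` around `x`. If neither is a neighbor
  -- of `x`, then some `w` between `y′` and `x` and some `z` between `x` and `y` have colors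
  -- adjacent to `b`; with `x` this makes three such elements, against `at-most-two`.
  neighbor-exists : ∀ a b x → a ∼ b → κ x ≡ a → ∃[ y ] κ y ≡ b × Neighbors x y
  neighbor-exists a b x@(lift i) a∼b κx≡a =
    let k , i<k , κk≡b = later i b
        h , h<i , κh≡b = sooner i b
        y , x<y , κy≡b , _ , first = first-above (linked⇒< i<k (up κk≡b)) κk≡b
        h<x = linked⇒< h<i (Linked-sym (up κh≡b))
        y′ , con , _ = prev {x = lift h} κh≡b κy≡b
          (ℤ<∧path⇒< (ℤ.<-trans h<i (<⇒ℤ< x<y)) (lower (proj₁ h<x) ◅◅ lower (proj₁ x<y)))
        y′<x = [ id , (λ x≤y′ → contradiction (proj₁ (proj₂ con))
                   (first y′ (lift (lower x≤y′) , λ x≈y′ → proj₁ a∼b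
                     (trans (sym κx≡a) (trans (cong letter (lower x≈y′)) (proj₁ (proj₂ con)))))
                     (proj₁ con))) ]′ (linked-compare {y′} {x} (Linked-sym (up (proj₁ (proj₂ con)))))
    in decide con y′<x x<y lem lem
    where
    up : ∀ {j} → letter j ≡ b → Linked (letter i) (letter j)
    up eq = inj₂ (subst₂ _∼_ (sym κx≡a) (sym eq) a∼b)
    -- The open interval without liftings, so that it lives at the level where `lem` decides.
    Between : ℤ → ℤ → ℤ → Set
    Between l r k = (l ℤ.< k × Path l k) × (k ℤ.< r × Path k r)
    not-cover : ∀ {u v} → ¬ ∃ (Between (lower u) (lower v)) → ¬ ∃ ⦅ u , v ⦆
    not-cover none (z , u<z , z<v) =
      none (lower z , (<⇒ℤ< u<z , lower (proj₁ u<z)) , (<⇒ℤ< z<v , lower (proj₁ z<v)))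
    decide : ∀ {y′ y} → Consecutive b y′ y → y′ < x → x < y →
             Dec (∃ (Between i (lower y))) → Dec (∃ (Between (lower y′) i)) → ∃[ y ] κ y ≡ b × Neighbors x y
    decide {y′} {y} (_ , _ , κy≡b , _) _ x<y (no none) _ = y , κy≡b , inj₁ (x<y , not-cover none)
    decide {y′} (_ , κy′≡b , _ , _) y′<x _ (yes _) (no none) = y′ , κy′≡b , inj₂ (y′<x , not-cover none)
    decide {y′} {y} con@(_ , κy′≡b , κy≡b , gap) y′<x x<y
      (yes (k , (i<k , p) , (k<y , q))) (yes (h , (y′<h , p′) , (h<x , q′))) =
      -- The last step of a path into `y` and the first step of a path out of `y′` join positions of
      -- linked letters; an arbitrary element between need not have a color adjacent to `b`.
      let z , k⇝z , (z<y , z-y) = last-edge q (ℤ.<⇒≢ k<y)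
          w , (y′<w , y′-w) , w⇝h = first-edge p′ (ℤ.<⇒≢ y′<h)
          x<z = ℤ<∧path⇒< {x} {lift z} (ℤ.<-≤-trans i<k (path⇒≤ k⇝z)) (p ◅◅ k⇝z)
          w<x = ℤ<∧path⇒< {lift w} {x} (ℤ.≤-<-trans (path⇒≤ w⇝h) h<x) (w⇝h ◅◅ q′)
          z<y = edge⇒< (z<y , z-y)
          y′<w = edge⇒< (y′<w , y′-w)
          z∈ = below y′<x x<z , z<y
          w∈ = y′<w , below w<x x<y
          w∼b = adjacent (gap (lift w) w∈) (subst (Linked (letter w)) κy′≡b (Linked-sym y′-w))
          z∼b = adjacent (gap (lift z) z∈) (subst (Linked (letter z)) κy≡b z-y)
      in contradiction (λ { (inj₁ (lift refl)) → w∈ , w∼b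
                          ; (inj₂ (inj₁ (lift refl))) → (y′<x , x<y) , subst (_∼ b) (sym κx≡a) a∼b
                          ; (inj₂ (inj₂ (lift refl))) → z∈ , z∼b })
                       (at-most-two con w<x x<z)
      where
      below : ∀ {r s t} → r < s → s < t → r < t
      below r<s s<t = ℤ<∧path⇒< (ℤ.<-trans (<⇒ℤ< r<s) (<⇒ℤ< s<t)) (lower (proj₁ r<s) ◅◅ lower (proj₁ s<t))
      adjacent : ∀ {d} → d ≢ b → Linked d b → d ∼ b
      adjacent d≢b (inj₁ d≡b) = contradiction d≡b d≢b
      adjacent d≢b (inj₂ d∼b) = d∼b

  module Count (a : Color) where

    hit : ℤ → ℕ
    hit i with letter i Fin.≟ a
    ... | yes _ = 1
    ... | no  _ = 0

    count⁺ count⁻ : ℕ → ℕ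
    count⁺ zero    = 0
    count⁺ (suc k) = hit (+ k) ℕ.+ count⁺ k
    count⁻ zero    = 0
    count⁻ (suc k) = hit -[1+ k ] ℕ.+ count⁻ k

    count : ℤ → ℤ
    count (+ k)    = + count⁺ k
    count -[1+ k ] = ℤ.- (+ count⁻ (suc k))

    private
      cancel : ∀ h n → + h ℤ.+ ℤ.- (+ (h ℕ.+ n)) ≡ ℤ.- (+ n)
      cancel h n = begin
        + h ℤ.+ ℤ.- (+ h ℤ.+ + n)          ≡⟨ cong (λ k → + h ℤ.+ k) (ℤ.neg-distrib-+ (+ h) (+ n)) ⟩
        + h ℤ.+ (ℤ.- (+ h) ℤ.+ ℤ.- (+ n)) ≡⟨ ℤ.+-assoc (+ h) (ℤ.- (+ h)) (ℤ.- (+ n)) ⟨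
        + h ℤ.- + h ℤ.+ ℤ.- (+ n)          ≡⟨ cong (ℤ._+ ℤ.- (+ n)) (ℤ.+-inverseʳ (+ h)) ⟩
        0ℤ ℤ.+ ℤ.- (+ n)                    ≡⟨ ℤ.+-identityˡ _ ⟩
        ℤ.- (+ n)                            ∎
        where open ≡-Reasoning

    count-suc : ∀ i → count (ℤ.suc i) ≡ + hit i ℤ.+ count i
    count-suc (+ k)        = refl
    count-suc -[1+ zero ]  = sym (cancel (hit -[1+ 0 ]) 0)
    count-suc -[1+ suc k ] = sym (cancel (hit -[1+ suc k ]) (count⁻ (suc k)))

    hit-yes : ∀ {i} → letter i ≡ a → count (ℤ.suc i) ≡ ℤ.suc (count i)
    hit-yes {i} eq = trans (count-suc i) (cong (λ h → + h ℤ.+ count i) hit≡1)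
      where
      hit≡1 : hit i ≡ 1
      hit≡1 with letter i Fin.≟ a
      ... | yes _ = refl
      ... | no ≢a = contradiction eq ≢a

    hit-no : ∀ {i} → letter i ≢ a → count (ℤ.suc i) ≡ count i
    hit-no {i} neq = trans (count-suc i) (trans (cong (λ h → + h ℤ.+ count i) hit≡0) (ℤ.+-identityˡ _))
      where
      hit≡0 : hit i ≡ 0
      hit≡0 with letter i Fin.≟ a
      ... | yes ≡a = contradiction ≡a neq
      ... | no _   = refl

    count-step : ∀ i → count i ℤ.≤ count (ℤ.suc i)
    count-step i = subst (count i ℤ.≤_)
      (sym (trans (count-suc i) (ℤ.+-comm (+ hit i) (count i)))) (i≤i+ (count i) (hit i))

    count-mono : ∀ {i j} → i ℤ.≤ j → count i ℤ.≤ count j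
    count-mono {i} i≤j = let k , eq = ≤⇒offset i≤j in subst (λ j → count i ℤ.≤ count j) (sym eq) (go k)
      where
      go : ∀ k → count i ℤ.≤ count (i ℤ.+ + k)
      go zero    = ℤ.≤-reflexive (cong count (sym (ℤ.+-identityʳ i)))
      go (suc k) = ℤ.≤-trans (go k)
        (subst (λ j → count (i ℤ.+ + k) ℤ.≤ count j) (suc+ i k) (count-step (i ℤ.+ + k)))

    count-strict : ∀ {i j} → letter i ≡ a → i ℤ.< j → count i ℤ.< count j
    count-strict {i} eq i<j = ℤ.<-≤-trans (subst (count i ℤ.<_) (sym (hit-yes eq)) (i<suc (count i)))
                                (count-mono (ℤ.i<j⇒suc[i]≤j i<j))

    -- A discrete intermediate value argument: `count` moves by 0 or 1, and by 1 exactly when it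
    -- passes a letter `a`.
    crossing : ∀ i k {m} → count i ℤ.≤ m → m ℤ.< count (i ℤ.+ + k) → ∃[ l ] letter l ≡ a × count l ≡ m
    crossing i zero    {m} ≤m m< = contradiction (subst (λ j → m ℤ.< count j) (ℤ.+-identityʳ i) m<) (ℤ.≤⇒≯ ≤m)
    crossing i (suc k) {m} ≤m m< with m ℤ.<? count (i ℤ.+ + k) | letter (i ℤ.+ + k) Fin.≟ a
    ... | yes m<ₖ | _      = crossing i k ≤m m<ₖ
    ... | no  m≮ₖ | yes eq = i ℤ.+ + k , eq , ℤ.≤-antisym (ℤ.≮⇒≥ m≮ₖ)
      (suc-cancel-≤ (ℤ.i<j⇒suc[i]≤j (subst (m ℤ.<_) (trans (cong count (sym (suc+ i k))) (hit-yes eq)) m<)))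
    ... | no  m≮ₖ | no neq = contradiction
      (subst (m ℤ.<_) (trans (cong count (sym (suc+ i k))) (hit-no neq)) m<) m≮ₖ

    unbounded⁺ : ∀ k → ∃[ i ] + k ℤ.≤ count i
    unbounded⁺ zero    = 0ℤ , ℤ.≤-refl
    unbounded⁺ (suc k) =
      let i , k≤ = unbounded⁺ k
          j , i<j , eq = later i a
      in ℤ.suc j , subst (+ suc k ℤ.≤_) (sym (hit-yes eq))
           (ℤ.+-monoʳ-≤ 1ℤ (ℤ.≤-trans k≤ (count-mono (ℤ.<⇒≤ i<j))))

    unbounded⁻ : ∀ k → ∃[ i ] count i ℤ.≤ ℤ.- (+ k)
    unbounded⁻ zero    = 0ℤ , ℤ.≤-refl
    unbounded⁻ (suc k) =
      let i , ≤-k = unbounded⁻ k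
          j , j<i , eq = sooner i a
      in j , suc-cancel-≤ (subst₂ ℤ._≤_ (hit-yes eq) (sym (cancel 1 k))
               (ℤ.≤-trans (count-mono (ℤ.i<j⇒suc[i]≤j j<i)) ≤-k))

    count-surjective : ∀ m → ∃[ l ] letter l ≡ a × count l ≡ m
    count-surjective m =
      let i , ≤-∣m∣ = unbounded⁻ ℤ.∣ m ∣
          j , ∣m∣< = unbounded⁺ (suc ℤ.∣ m ∣)
          ≤m = ℤ.≤-trans ≤-∣m∣ (-∣m∣≤m m)
          m< = ℤ.<-≤-trans (ℤ.≤-<-trans (m≤∣m∣ m) (i<suc (+ ℤ.∣ m ∣))) ∣m∣<
          k , eq = ≤⇒offset {i} {j} (ℤ.≮⇒≥ λ j<i → ℤ.<⇒≱ m< (ℤ.≤-trans (count-mono (ℤ.<⇒≤ j<i)) ≤m))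
      in crossing i k ≤m (subst (λ j → m ℤ.< count j) eq m<)
      where
      m≤∣m∣ : ∀ m → m ℤ.≤ + ℤ.∣ m ∣
      m≤∣m∣ (+ n)    = ℤ.≤-refl
      m≤∣m∣ -[1+ n ] = -≤+
      -∣m∣≤m : ∀ m → ℤ.- (+ ℤ.∣ m ∣) ℤ.≤ m
      -∣m∣≤m (+ n)    = ℤ.≤-trans ℤ.neg-≤-pos (+≤+ z≤n)
      -∣m∣≤m -[1+ n ] = ℤ.≤-refl

    isomorphism : Σ (∃ (OfColor a) → ℤ) λ f → IsOrderIsomorphism (_≈_ on proj₁) _≡_ (_≤_ on proj₁) ℤ._≤_ f
    isomorphism = count ∘ lower ∘ proj₁ , record
      { isOrderMonomorphism = record
        { isOrderHomomorphism = record
          { cong = λ (lift e) → cong count e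
          ; mono = λ (lift p) → count-mono (path⇒≤ p)
          }
        ; injective = λ {x} {y} → injective x y
        ; cancel    = λ {x} {y} → cancel-≤ x y
        }
      ; surjective = λ m → let l , eq , count≡ = count-surjective m
                           in (lift l , eq) , λ (lift e) → trans (cong count e) count≡
      }
      where
      injective : ∀ (x y : ∃ (OfColor a)) → count (lower (proj₁ x)) ≡ count (lower (proj₁ y)) → proj₁ x ≈ proj₁ y
      injective (lift i , eqi) (lift j , eqj) c≡ with ℤ.<-cmp i j
      ... | tri< i<j _ _ = contradiction c≡ (ℤ.<⇒≢ (count-strict eqi i<j))
      ... | tri≈ _ i≡j _ = lift i≡j
      ... | tri> _ _ j<i = contradiction (sym c≡) (ℤ.<⇒≢ (count-strict eqj j<i))
      cancel-≤ : ∀ (x y : ∃ (OfColor a)) → count (lower (proj₁ x)) ℤ.≤ count (lower (proj₁ y)) → proj₁ x ≤ proj₁ y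
      cancel-≤ (x , eqx) (y , eqy) c≤ with linked-compare {y} {x} (inj₁ (trans eqy (sym eqx)))
      ... | inj₁ y<x = contradiction c≤ (ℤ.<⇒≱ (count-strict eqy (<⇒ℤ< y<x)))
      ... | inj₂ x≤y = x≤y

  heap-isFullHeap : IsFullHeap heap
  heap-isFullHeap = record
    { G1-color    = λ a {x} {y} κx≡a κy≡a → linked-comparable x y (inj₁ (trans κx≡a (sym κy≡a)))
    ; G1-adjacent = λ b c b∼c {x} {y} x∈ y∈ → linked-comparable x y (join b∼c x∈ y∈)
    ; G2          = minimality
    ; G3          = λ a → Count.isomorphism a
    ; G4          = neighbor-exists
    ; G5          = λ a x y → consecutive-closed
    }
    where
    join : ∀ {b c d e} → b ∼ c → d ≡ b ⊎ d ≡ c → e ≡ b ⊎ e ≡ c → Linked d e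
    join b∼c (inj₁ refl) (inj₁ refl) = inj₁ refl
    join b∼c (inj₁ refl) (inj₂ refl) = inj₂ b∼c
    join b∼c (inj₂ refl) (inj₁ refl) = inj₂ (∼-sym b∼c)
    join b∼c (inj₂ refl) (inj₂ refl) = inj₁ refl
    -- Every step of a path lies inside one of the chains of G1, and transitivity does the rest.
    minimality : ∀ (_≼_ : Rel Carrier (c ⊔ ℓ₁ ⊔ ℓ₂)) → IsPartialOrder _≈_ _≼_ →
                 (∀ a → ColoredPoset.ExtendsOrderOn heap (OfColor a) _≼_) →
                 (∀ b c → b ∼ c → ColoredPoset.ExtendsOrderOn heap (λ x → κ x ≡ b ⊎ κ x ≡ c) _≼_) →
                 ∀ x y → x ≤ y → x ≼ y
    minimality _≼_ po mono₁ mono₂ (lift i) (lift j) (lift p) = go p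
      where
      go : ∀ {i j} → Path i j → lift i ≼ lift j
      go ε                    = IsPartialOrder.refl po
      go ((i<k , inj₁ eq) ◅ p) = IsPartialOrder.trans po
        (mono₁ _ refl (sym eq) (lift ((i<k , inj₁ eq) ◅ ε))) (go p)
      go ((i<k , inj₂ i∼k) ◅ p) = IsPartialOrder.trans po
        (mono₂ _ _ i∼k (inj₁ refl) (inj₂ refl) (lift ((i<k , inj₂ i∼k) ◅ ε))) (go p)

  heap-connected : ColorConnected (c ⊔ ℓ₁ ⊔ ℓ₂) → Connected
  heap-connected colors (B , C , (x , x∈B) , (y , y∈C) , total , apart) =
    let z , κz≡κy , z∈B = colors X
          (λ {a} {b} a∼b (v , κv≡a , v∈B) →
            let l , _ , eq = later 0ℤ b
            in lift l , eq , stay v∈B (linked-comparable v (lift l) (inj₂ (subst₂ _∼_ (sym κv≡a) (sym eq) a∼b))))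
          {κ x} {κ y} (x , refl , x∈B)
    in apart z∈B y∈C (linked-comparable z y (inj₁ κz≡κy))
    where
    X : Color → Set (c ⊔ ℓ₁ ⊔ ℓ₂)
    X a = ∃[ v ] κ v ≡ a × B v
    stay : ∀ {v w} → B v → Comparable v w → B w
    stay {v} {w} v∈B cmp = [ id , (λ w∈C → contradiction cmp (apart v∈B w∈C)) ]′ (total w)

-- Infinite d-complete posets

module DComplete {c ℓ₁ ℓ₂ : Level} (em : ExcludedMiddle (c ⊔ ℓ₁ ⊔ ℓ₂))
  {Γ : DynkinDiagram} (P : ColoredPoset Γ c ℓ₁ ℓ₂) (dComplete : IsDComplete P)
  (connected : ColoredPoset.Connected P) (infinite : ColoredPoset.Infinite P) where
  open DynkinDiagram Γ
  open Weights Γ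
  open Words Γ
  open ColoredPoset P
  open Poset poset using (module Eq; antisym)
    renaming (refl to ≤-refl; trans to ≤-trans; reflexive to ≤-reflexive)
  open PosetProperties poset using (<-trans; <-irrefl; <-respˡ-≈; <-respʳ-≈)
  open Membership Eq.setoid using (_∈_; _∉_)
  open IsDComplete dComplete

  lem : ExcludedMiddle 0ℓ
  lem = map′ lower lift (em {Lift (c ⊔ ℓ₁ ⊔ ℓ₂) _})

  _≤?_ : Decidable _≤ᴾ_
  x ≤? y = map′ lower lift (em {Lift (c ⊔ ℓ₁ ⊔ ℓ₂) (x ≤ᴾ y)})

  heapLike : IsHeapLike P
  heapLike = dComplete⇒heapLike P dComplete

  open IsHeapLike heapLike
  open HeapLike P _≤?_ heapLike hiding (weight)
  open WordLimits lem Γ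

  element : ∀ a → ∃[ x ] κ x ≡ a
  element a = let x , eq = Surjection.surjective coloring a in x , eq Eq.refl

  closed-upward : (X : Color → Set (c ⊔ ℓ₁ ⊔ ℓ₂)) → (∀ {a b} → a ∼ b → X a → X b) →
                  ∀ {x y} → x ≤ᴾ y → X (κ x) → X (κ y)
  closed-upward X closed {x} {y} = go (climb y x)
    where
    go : ∀ {x} → Acc (Climb y) x → x ≤ᴾ y → X (κ x) → X (κ y)
    go {x} (acc rs) x≤y Xx with x ≈? y
    ... | yes x≈y = subst X (κ-cong x≈y) Xx
    ... | no  x≉y = let z , x⋖z , z≤y = cover-above (x≤y , x≉y)
                    in go (rs (proj₁ x⋖z , z≤y)) z≤y (closed (NA x z (inj₁ x⋖z)) Xx)

  -- By NA a property that spreads along adjacency is passed along covers, and so is its negation.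
  -- If it held for some colors only, `P` would split into two unrelated parts.
  colorConnected : ColorConnected (c ⊔ ℓ₁ ⊔ ℓ₂)
  colorConnected X closed {a} {b} Xa = decidable-stable em λ ¬Xb → connected
    ( (X ∘ κ) , (λ x → ¬ X (κ x))
    , (proj₁ (element a) , subst X (sym (proj₂ (element a))) Xa)
    , (proj₁ (element b) , ¬Xb ∘ subst X (proj₂ (element b)))
    , (λ x → split (em {X (κ x)}))
    , λ { Xx ¬Xy (inj₁ x≤y) → ¬Xy (closed-upward X closed x≤y Xx)
        ; Xx ¬Xy (inj₂ y≤x) → closed-upward (¬_ ∘ X) (λ a∼b ¬Xa → ¬Xa ∘ closed (∼-sym a∼b)) y≤x ¬Xy Xx })
    where
    split : ∀ {A : Set (c ⊔ ℓ₁ ⊔ ℓ₂)} → Dec A → A ⊎ ¬ A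
    split (yes p) = inj₁ p
    split (no ¬p) = inj₂ ¬p

  Bounded : Color → Set (c ⊔ ℓ₁ ⊔ ℓ₂)
  Bounded a = ∃ (MaximalOfColor a)

  -- Elements of color `b` are comparable with the maximal `x` of color `a`. Those above `x` are
  -- finitely many by UCB1, those between a given `z` and `x` by local finiteness, so a topmost one
  -- exists.
  bounded-spreads : ∀ {a b} → a ∼ b → Bounded a → Bounded b
  bounded-spreads {a} {b} a∼b (x , κx≡a , x-max) =
    let z , κz≡b = element b
        _ , (xs , (_ , e) , _) , _ = UCB1 a x (κx≡a , x-max)
        m , κm≡b , _ , max = Dual.minimal {R = λ v → κ v ≡ b} (λ v → κ v Fin.≟ b)
          (λ v≈w κv≡b → trans (sym (κ-cong v≈w)) κv≡b) (interval z x ++ xs) κz≡b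
          (λ v z<v κv≡b → [ (λ x<v → Membershipₚ.∈-++⁺ʳ Eq.setoid (interval z x)
                                (Equivalence.from (e v) (x<v , subst₂ _∼_ (sym κv≡b) (sym κx≡a) (∼-sym a∼b))))
                          , (λ v≤x → Membershipₚ.∈-++⁺ˡ Eq.setoid (∈-interval (proj₁ z<v) v≤x))
                          ]′ (linked-compare {x} {v} (inj₂ (subst₂ _∼_ (sym κx≡a) (sym κv≡b) a∼b))))
    in m , κm≡b , λ y κy≡b m<y → max y (dual-<⁻ P m<y) κy≡b
    where module Dual = FinitePoset (PosetProperties.≥-poset poset) (flip _≤?_)

  ∈-union : ∀ {n z} (f : Fin n → List Carrier) i → z ∈ f i → z ∈ concat (tabulate f)
  ∈-union f i z∈ = Membershipₚ.∈-concat⁺ Eq.setoid (Any.tabulate⁺ i z∈)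

  fresh : ∀ L → ∃[ x ] x ∉ L
  fresh L = decidable-stable (map′ lower lift (em {Lift (c ⊔ ℓ₁ ⊔ ℓ₂) (∃[ x ] x ∉ L)})) λ none →
    infinite (enumerate {R = U} (λ _ → yes _) (λ _ _ → _) L
      (λ z _ → decidable-stable (any? (z ≈?_) L) λ z∉L → none (z , z∉L)))

  not-all-bounded : ¬ (∀ a → Bounded a)
  not-all-bounded bounded = no-dominant-word heaped dominant
    where
    module P* = ColoredPoset (dual P)
    top : Color → Carrier
    top a = proj₁ (bounded a)
    ≤top : ∀ z → z ≤ᴾ top (κ z)
    ≤top z = let t , κt≡ , max = bounded (κ z)
             in [ (λ t<z → contradiction t<z (max z refl)) , id ]′ (linked-compare (inj₁ κt≡))
    open Enumeration P*.poset (flip _≤?_) {D = λ _ → ⊥} (λ _ → no id) (λ _ ())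
    -- What lies above `y` is covered by the intervals from `y` to the maxima of the finitely many
    -- colors, so the dual order has the finite lower sets that a listing needs.
    s : Sequence
    s = sequence (λ y → concat (tabulate (λ a → interval y (top a))) ,
                        λ z y≤z _ → ∈-union (λ a → interval y (top a)) (κ z) (∈-interval y≤z (≤top z)))
                 (λ L → let x , x∉L = fresh L in x , id , x∉L)
    open Sequence s
    open SequenceWord (dual P) (dual-heapLike P heapLike) (flip _≤?_) {D = λ _ → ⊥} (λ _ → no id) (λ _ ()) s
      hiding (κ-cong)
    above : ∀ {z} m → p m <ᴾ z → ∃[ j ] j ℕ.< m × z ≈ p j
    above m pm<z = [ (λ ()) , id ]′ (below m (dual-<⁻ P pm<z))
    -- Everything above a listed element is listed before it. So the first occurrence of `a` is the
    -- maximal element of its color, and the weight listed before it is the sum in UCB1.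
    dominant : ∀ {a m v} → Till word a 0 m v → v ℕ.≤ 1
    dominant {a} {m} {v} till =
      let κm≡a = till-end till
          pm-max = λ y κy≡a pm<y → let j , j<m , y≈pj = above m pm<y
                                   in till-free till z≤n j<m (trans (sym (κ-cong y≈pj)) κy≡a)
          t , total , t≤1 = UCB1 a (p m) (κm≡a , pm-max)
          t≡v = till-sum {A = UpperAdjacent (p m)} till total
            (λ (pm<z , _) _ → let j , j<m , z≈pj = above m pm<z in j , z≤n , j<m , z≈pj)
            (λ {j} _ j<m κj∼a → let κj∼κm = subst (word j ∼_) (sym κm≡a) κj∼a in
               dual-< P (index<⇒< j<m (Sum.swap (linked-comparable _ _ (inj₂ κj∼κm)))) , κj∼κm)
            (λ (_ , κz∼κm) κz≡a → proj₁ κz∼κm (trans κz≡a (sym κm≡a)))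
      in ℤ.drop‿+≤+ (subst (ℤ._≤ 1ℤ) t≡v t≤1)

  unbounded : ∀ a → ¬ Bounded a
  unbounded a bounded = not-all-bounded λ b → colorConnected Bounded bounded-spreads bounded

  -- Abstract, as otherwise normalization unfolds the whole bounded case.
  abstract
    higher : ∀ x → ∃[ y ] κ y ≡ κ x × x <ᴾ y
    higher x = decidable-stable em λ none → unbounded (κ x) (x , refl , λ y κy≡ x<y → none (y , κy≡ , x<y))

  -- Climbing through the color of `y` leaves the part below `x` after finitely many steps, and
  -- comparability then puts the element reached above `x`.
  higher-linked : ∀ x y → Linked (κ x) (κ y) → ∃[ z ] κ z ≡ κ y × x <ᴾ z
  higher-linked x y l = go y refl (climb x y)
    where
    go : ∀ z → κ z ≡ κ y → Acc (Climb x) z → ∃[ w ] κ w ≡ κ y × x <ᴾ w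
    go z κz≡ (acc rs) with higher z
    ... | w , κw≡κz , z<w with linked-compare {x} {w} (subst (Linked (κ x)) (sym (trans κw≡κz κz≡)) l)
    ...   | inj₁ x<w = w , trans κw≡κz κz≡ , x<w
    ...   | inj₂ w≤x = go w (trans κw≡κz κz≡) (rs (z<w , w≤x))

  higher-of-color : ∀ x b → ∃[ y ] κ y ≡ b × x <ᴾ y
  higher-of-color x b = colorConnected (λ b → ∃[ y ] κ y ≡ b × x <ᴾ y)
    (λ {a} {b} a∼b (y , κy≡a , x<y) →
      let w , κw≡b = element b
          z , κz≡κw , y<z = higher-linked y w (inj₂ (subst₂ _∼_ (sym κy≡a) (sym κw≡b) a∼b))
      in z , trans κz≡κw κw≡b , <-trans x<y y<z)
    (let y , κy≡ , x<y = higher x in y , κy≡ , x<y)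

  directed : ∀ x y → ∃[ z ] x ≤ᴾ z × y ≤ᴾ z
  directed x y = let z , κz≡κy , x<z = higher-of-color x (κ y)
                 in [ (λ z<y → y , ≤-trans (proj₁ x<z) (proj₁ z<y) , ≤-refl)
                    , (λ y≤z → z , proj₁ x<z , y≤z) ]′ (linked-compare (inj₁ κz≡κy))

  upper : ∀ {n} x (g : Fin n → Carrier) → ∃[ t ] x ≤ᴾ t × (∀ i → g i ≤ᴾ t)
  upper {zero}  x g = x , ≤-refl , λ ()
  upper {suc n} x g =
    let t , x≤t , g≤t = upper x (g ∘ Fin.suc)
        z , t≤z , g0≤z = directed t (g Fin.zero)
    in z , ≤-trans x≤t t≤z , λ { Fin.zero → g0≤z ; (Fin.suc i) → ≤-trans (g≤t i) t≤z }

  upper-list : ∀ x L → ∃[ t ] x ≤ᴾ t × (∀ {z} → z ∈ L → z ≤ᴾ t)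
  upper-list x []      = x , ≤-refl , λ ()
  upper-list x (y ∷ L) =
    let t , x≤t , L≤t = upper-list x L
        z , t≤z , y≤z = directed t y
    in z , ≤-trans x≤t t≤z , λ { (here w≈y) → ≤-trans (≤-reflexive w≈y) y≤z ; (there w∈) → ≤-trans (L≤t w∈) t≤z }

  private
    -- One element is chosen in each color. What is not below their common bound `t` lies above the
    -- chosen element of its own color, so only finitely many such elements lie below a given one.
    base : ∃[ t ] (∀ a → proj₁ (element a) ≤ᴾ t)
    base = let x , _ = fresh []
               t , _ , ≤t = upper x (proj₁ ∘ element) in t , ≤t

  t₀ : Carrier
  t₀ = proj₁ base

  open Enumeration poset _≤?_ {D = _≤ᴾ t₀} (_≤? t₀) ≤-trans public

  abstract
    tail : Sequence
    tail = sequence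
      (λ y → concat (tabulate (λ a → interval (proj₁ (element a)) y)) , λ z z≤y z≰t →
        ∈-union (λ a → interval (proj₁ (element a)) y) (κ z) (∈-interval
          ([ (λ z<e → contradiction (≤-trans (proj₁ z<e) (proj₂ base (κ z))) z≰t) , id ]′
             (linked-compare (inj₁ (sym (proj₂ (element (κ z))))))) z≤y))
      (λ L → let T , t≤T , L≤T = upper-list t₀ L
                 x , _ , T<x = higher T
             in x , (λ x≤t → <-irrefl Eq.refl (<-≤-trans T<x (≤-trans x≤t t≤T)))
                  , (λ x∈L → <-irrefl Eq.refl (<-≤-trans T<x (L≤T x∈L))))

  open Sequence tail public
  open SequenceWord P heapLike _≤?_ {D = _≤ᴾ t₀} (_≤? t₀) ≤-trans tail public using (word; heaped)

  escape : ∀ {a} → Recurrent word a → ∀ y → ∃[ k ] word k ≡ a × ¬ p k ≤ᴾ y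
  escape {a} rec y = let k , _ , eq = rec 0 in go k eq (climb y (p k))
    where
    go : ∀ k → word k ≡ a → Acc (Climb y) (p k) → ∃[ k ] word k ≡ a × ¬ p k ≤ᴾ y
    go k eq (acc rs) with rec (suc k)
    ... | l , k<l , eq′ with p l ≤? y
    ...   | no  pl≰y = l , eq′ , pl≰y
    ...   | yes pl≤y = go l eq′ (rs (index<⇒< k<l (linked-comparable _ _ (inj₁ (trans eq (sym eq′)))) , pl≤y))

  overtake : ∀ {a} → Recurrent word a → ∀ y → Linked (κ y) a → ∃[ k ] y <ᴾ p k
  overtake rec y l =
    let k , eq , pk≰y = escape rec y
    in k , [ id , (λ pk≤y → contradiction pk≤y pk≰y) ]′ (linked-compare (subst (Linked (κ y)) (sym eq) l))

  recurrent : ∀ a → Recurrent word a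
  recurrent a = lower (colorConnected (Lift (c ⊔ ℓ₁ ⊔ ℓ₂) ∘ Recurrent word)
      (λ a∼b (lift rec) → lift (spread a∼b rec))
      (lift (proj₂ (eventually-recurrent word) (proj₁ (eventually-recurrent word)) ℕ.≤-refl)))
    where
    -- Take `y` of color `b` above `t₀` and above the first `K` listed elements. The recurrent color
    -- `a` eventually overtakes `y`; so `y` is listed, and its index is at least `K`.
    spread : ∀ {a b} → a ∼ b → Recurrent word a → Recurrent word b
    spread {a} {b} a∼b rec K =
      let T , t≤T , p≤T = upper {K} t₀ (p ∘ toℕ)
          y , κy≡b , T<y = higher-of-color T b
          k , y<pk = overtake rec y (inj₂ (∼-sym (subst (a ∼_) (sym κy≡b) a∼b)))
      in [ (λ y≤t → contradiction (<-≤-trans T<y (≤-trans y≤t t≤T)) (<-irrefl Eq.refl))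
         , (λ (j , _ , y≈pj) → j , ℕ.≮⇒≥ (λ j<K → <-irrefl Eq.refl (<-≤-trans T<y (≤-trans (≤-reflexive y≈pj)
               (subst (λ i → p i ≤ᴾ T) (Fin.toℕ-fromℕ< j<K) (p≤T (fromℕ< j<K))))))
             , trans (sym (κ-cong y≈pj)) κy≡b)
         ]′ (below k y<pk)

  exhausts : ∀ {z} → ¬ z ≤ᴾ t₀ → ∃[ j ] z ≈ p j
  exhausts {z} z≰t =
    let k , z<pk = overtake (recurrent (κ z)) z (inj₁ refl)
    in [ (λ z≤t → contradiction z≤t z≰t) , (λ (j , _ , z≈pj) → j , z≈pj) ]′ (below k z<pk)

-- Embedding a poset into the heap of a word

module _ {c ℓ₁ ℓ₂ : Level} {Γ : DynkinDiagram} (P : ColoredPoset Γ c ℓ₁ ℓ₂) where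
  open DynkinDiagram Γ
  open ColoredPoset P

  NeighborsAdjacent : Set (c ⊔ ℓ₁ ⊔ ℓ₂)
  NeighborsAdjacent = ∀ x y → Neighbors x y → κ x ∼ κ y

  Unbounded : Set (c ⊔ ℓ₁ ⊔ ℓ₂)
  Unbounded = ∀ x → ∃[ y ] κ y ≡ κ x × x <ᴾ y

  -- h lists an up-closed part of P in the order of the nonnegative letters.
  record UpperListing (letter : ℤ → Color) : Set (c ⊔ ℓ₁ ⊔ ℓ₂) where
    field
      h            : ℕ → Carrier
      h-letter     : ∀ k → letter (+ k) ≡ κ (h k)
      h-reflects-< : ∀ {i j} → h i <ᴾ h j → i ℕ.< j
      h-increasing : ∀ {i j} → i ℕ.< j → Comparable (h i) (h j) → h i <ᴾ h j
      h-injective  : ∀ {i j} → h i ≈ h j → i ≡ j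

    High : Carrier → Set ℓ₁
    High x = ∃[ k ] h k ≈ x

    field
      High?    : ∀ x → Dec (High x)
      high-up  : ∀ {x y} → x ≤ᴾ y → High x → High y
      top      : Carrier
      low≤top  : ∀ {x} → ¬ High x → x ≤ᴾ top

module Embedding {c ℓ₁ ℓ₂ : Level} {Γ : DynkinDiagram} (P : ColoredPoset Γ c ℓ₁ ℓ₂)
  (_≤?_ : Decidable (ColoredPoset._≤ᴾ_ P)) (heapLike : IsHeapLike P)
  (neighbors-adjacent : NeighborsAdjacent P) (higher : Unbounded P)
  (lem : ExcludedMiddle 0ℓ) (biword : Firing.BiInfiniteWord Γ)
  (listing : UpperListing P (Firing.BiInfiniteWord.letter biword)) where

  open ColoredPoset P
  open DynkinDiagram Γ
  open Firing.BiInfiniteWord biword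
  open UpperListing listing
  open Weights Γ
  open Poset poset using (module Eq; antisym)
    renaming (refl to ≤-refl; trans to ≤-trans; reflexive to ≤-reflexive)
  open PosetProperties poset using (<-trans; <-irrefl; <-respˡ-≈; <-respʳ-≈)
  open IsHeapLike heapLike
  open HeapLike P _≤?_ heapLike
  open WordHeap lem Γ biword c ℓ₁ ℓ₂ using
    (Edge; Path; path⇒≤; heap; heap-heapLike; edge⇒<; linked⇒<; <⇒ℤ<)
    renaming (_≤?_ to _≤?ᵠ_; ice to iceᵠ)
  module Q = ColoredPoset heap
  module QH = HeapLike heap _≤?ᵠ_ heap-heapLike

  Consecutiveᵠ : Color → ℤ → ℤ → Set (c ⊔ ℓ₁ ⊔ ℓ₂)
  Consecutiveᵠ a i j = Q.Consecutive a (lift i) (lift j)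

  -- The graph of the embedding. Facts about it follow by induction on derivations, and
  -- `placed-unique` carries them over to `ι` without unfolding the recursion in `place`.
  data Placed : Carrier → ℤ → Set (c ⊔ ℓ₁ ⊔ ℓ₂) where
    high : ∀ {x} k → h k ≈ x → Placed x (+ k)
    low  : ∀ {a x y i j} → ¬ High x → Consecutive a x y → Consecutiveᵠ a i j → Placed y j → Placed x i

  placed-color : ∀ {x i} → Placed x i → letter i ≡ κ x
  placed-color (high k hk≈x) = trans (h-letter k) (κ-cong hk≈x)
  placed-color (low _ (_ , κx≡a , _) (_ , κi≡a , _) _) = trans κi≡a (sym κx≡a)

  placed-unique : ∀ {x y i j} → x ≈ y → Placed x i → Placed y j → i ≡ j
  placed-unique x≈y (high k hk≈x) (high l hl≈y) =
    cong +_ (h-injective (Eq.trans hk≈x (Eq.trans x≈y (Eq.sym hl≈y))))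
  placed-unique x≈y (high k hk≈x) (low ¬hy _ _ _) = contradiction (k , Eq.trans hk≈x x≈y) ¬hy
  placed-unique x≈y (low ¬hx _ _ _) (high k hk≈y) = contradiction (k , Eq.trans hk≈y (Eq.sym x≈y)) ¬hx
  placed-unique x≈y (low _ con conᵠ pl) (low _ con′ conᵠ′ pl′) =
    lower (QH.consecutive-uniqueˡ conᵠ conᵠ′ (lift (placed-unique (consecutive-uniqueʳ con con′ x≈y) pl pl′)))

  successor : ∀ x → ∃[ y ] Consecutive (κ x) x y
  successor x = let y , κy≡ , x<y = higher x
                    z , con , _   = next refl κy≡ x<y
                in z , con

  predecessor : ∀ j → ∃[ i ] Consecutiveᵠ (letter j) i j
  predecessor j = let i , i<j , eq = sooner j (letter j)
                      z , con , _  = QH.prev eq refl (linked⇒< i<j (inj₁ eq))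
                  in lower z , con

  place : ∀ x → ∃[ i ] Placed x i
  place x = go x (climb top x)
    where
    recolor : ∀ {a x y i j} → Consecutive a x y → Placed y j → Consecutiveᵠ (letter j) i j → Consecutiveᵠ a i j
    recolor {i = i} {j} (_ , _ , κy≡a , _) pl = subst (λ a → Consecutiveᵠ a i j) (trans (placed-color pl) κy≡a)
    go : ∀ x → Acc (Climb top) x → ∃[ i ] Placed x i
    go x (acc rs) with High? x | successor x
    ... | yes (k , hk≈x) | _ = + k , high k hk≈x
    -- A high `y` need not lie below `top`, so the induction does not reach it and its position is
    -- given directly.
    ... | no ¬hx | y , con with High? y
    ...   | yes (k , hk≈y) = let i , conᵠ = predecessor (+ k)
                                 pl = high k hk≈y
                             in i , low ¬hx con (recolor con pl conᵠ) pl
    ...   | no ¬hy = let j , pl = go y (rs (proj₁ con , low≤top ¬hy))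
                         i , conᵠ = predecessor j
                     in i , low ¬hx con (recolor con pl conᵠ) pl

  ι : Carrier → ℤ
  ι x = proj₁ (place x)

  ι-placed : ∀ x → Placed x (ι x)
  ι-placed x = proj₂ (place x)

  ι-color : ∀ x → letter (ι x) ≡ κ x
  ι-color x = placed-color (ι-placed x)

  ι-cong : ∀ {x y} → x ≈ y → ι x ≡ ι y
  ι-cong x≈y = placed-unique x≈y (ι-placed _) (ι-placed _)

  ι-high : ∀ {x} k → h k ≈ x → ι x ≡ + k
  ι-high k hk≈x = placed-unique Eq.refl (ι-placed _) (high k hk≈x)

  ι-low : ∀ {a x y} → ¬ High x → Consecutive a x y → Consecutiveᵠ a (ι x) (ι y)
  ι-low {a} {x} {y} ¬hx con = go (ι-placed x)
    where
    go : ∀ {i} → Placed x i → Consecutiveᵠ a i (ι y)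
    go (high k hk≈x) = contradiction (k , hk≈x) ¬hx
    go {i} (low {a = b} {y = y′} _ con′ conᵠ pl) =
      subst₂ (λ d j → Consecutiveᵠ d i j)
        (trans (sym (proj₁ (proj₂ con′))) (proj₁ (proj₂ con)))
        (placed-unique (consecutive-uniqueʳ con′ con Eq.refl) pl (ι-placed y)) conᵠ

  high-< : ∀ {x k} l → h k ≈ x → k ℕ.< l → Linked (κ x) (κ (h l)) → x <ᴾ h l
  high-< l hk≈x k<l lk = <-respˡ-≈ hk≈x
    (h-increasing k<l (linked-comparable _ _ (subst (λ b → Linked b (κ (h l))) (sym (κ-cong hk≈x)) lk)))

  -- Linked pairs suffice: covers in `P` are of this kind, and so are the edges that generate the
  -- order of the heap. Both fields are proved together, as each uses the other at higher elements.
  record Faithful (z : Carrier) : Set (c ⊔ ℓ₁ ⊔ ℓ₂) where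
    field
      preserves : ∀ {v} → Linked (κ z) (κ v) → z <ᴾ v → ι z ℤ.< ι v
      lifts     : ∀ {q} → Linked (κ z) (letter q) → ι z ℤ.< q → ∃[ v ] ι v ≡ q × z <ᴾ v
  open Faithful

  high-faithful : ∀ {z} → High z → Faithful z
  high-faithful {z} (k , hk≈z) = record { preserves = preserves′ ; lifts = lifts′ }
    where
    preserves′ : ∀ {v} → Linked (κ z) (κ v) → z <ᴾ v → ι z ℤ.< ι v
    preserves′ _ z<v = let l , hl≈v = high-up (proj₁ z<v) (k , hk≈z)
      in subst₂ ℤ._<_ (sym (ι-high k hk≈z)) (sym (ι-high l hl≈v))
           (+<+ (h-reflects-< (<-respˡ-≈ (Eq.sym hk≈z) (<-respʳ-≈ (Eq.sym hl≈v) z<v))))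
    lifts′ : ∀ {q} → Linked (κ z) (letter q) → ι z ℤ.< q → ∃[ v ] ι v ≡ q × z <ᴾ v
    lifts′ {q} l ιz<q with subst (ℤ._< q) (ι-high k hk≈z) ιz<q
    ... | +<+ {n = m} k<m = h m , ι-high m Eq.refl , high-< m hk≈z k<m (subst (Linked (κ z)) (h-letter m) l)

  module Step {z z⁺} (low-z : ¬ High z) (con : Consecutive (κ z) z z⁺)
              (above : ∀ {v} → z <ᴾ v → Faithful v) where
    a : Color
    a = κ z

    conᵠ : Consecutiveᵠ a (ι z) (ι z⁺)
    conᵠ = ι-low low-z con

    z<z⁺ : z <ᴾ z⁺
    z<z⁺ = proj₁ con

    ιz<ιz⁺ : ι z ℤ.< ι z⁺
    ιz<ιz⁺ = <⇒ℤ< (proj₁ conᵠ)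

    κz⁺≡a : κ z⁺ ≡ a
    κz⁺≡a = proj₁ (proj₂ (proj₂ con))

    linked⁺ : ∀ {b} → Linked a b → Linked (κ z⁺) b
    linked⁺ = subst (λ d → Linked d _) (sym κz⁺≡a)

    same-color : ∀ {v} → κ v ≡ a → z <ᴾ v → ι z ℤ.< ι v
    same-color {v} κv≡a z<v with linked-compare {z⁺} {v} (inj₁ (trans κz⁺≡a (sym κv≡a)))
    ... | inj₁ z⁺<v = ℤ.<-trans ιz<ιz⁺ (preserves (above z<z⁺) (inj₁ (trans κz⁺≡a (sym κv≡a))) z⁺<v)
    ... | inj₂ v≤z⁺ = subst (ι z ℤ.<_) (sym (ι-cong (decidable-stable (v ≈? z⁺) λ v≉z⁺ →
                        proj₂ (proj₂ (proj₂ con)) v (z<v , (v≤z⁺ , v≉z⁺)) κv≡a))) ιz<ιz⁺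

    -- If `ι v` were below `ι z`, then `lifts` at `v` would give some `w` above `v` with the same
    -- image as `z`. This `w` has the color of `z` and lies above it, so `same-color` separates the
    -- images.
    inside : ∀ {v} → Linked a (κ v) → z <ᴾ v → v <ᴾ z⁺ → ι z ℤ.< ι v × ι v ℤ.< ι z⁺
    inside {v} l z<v v<z⁺ = ιz<ιv (ℤ.<-cmp (ι z) (ι v)) , preserves (above z<v) (Linked-sym (linked⁺ l)) v<z⁺
      where
      ιz<ιv : _ → ι z ℤ.< ι v
      ιz<ιv (tri< lt _ _) = lt
      ιz<ιv (tri≈ _ eq _) = contradiction (trans (sym (ι-color v)) (trans (cong letter (sym eq)) (ι-color z)))
                              (proj₂ (proj₂ (proj₂ con)) v (z<v , v<z⁺))
      ιz<ιv (tri> _ _ gt) =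
        let w , ιw≡ιz , v<w = lifts (above z<v) (Linked-sym (subst (λ b → Linked b _) (sym (ι-color z)) l)) gt
        in contradiction (sym ιw≡ιz) (ℤ.<⇒≢ (same-color
             (trans (sym (ι-color w)) (trans (cong letter ιw≡ιz) (ι-color z))) (<-trans z<v v<w)))

    preserves-z : ∀ {v} → Linked a (κ v) → z <ᴾ v → ι z ℤ.< ι v
    preserves-z {v} l z<v with linked-compare {z⁺} {v} (linked⁺ l)
    ... | inj₁ z⁺<v = ℤ.<-trans ιz<ιz⁺ (preserves (above z<z⁺) (linked⁺ l) z⁺<v)
    ... | inj₂ v≤z⁺ with v ≈? z⁺
    ...   | yes v≈z⁺ = subst (ι z ℤ.<_) (sym (ι-cong v≈z⁺)) ιz<ιz⁺
    ...   | no  v≉z⁺ = proj₁ (inside l z<v (v≤z⁺ , v≉z⁺))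

    module PS = Summation Eq.setoid
    module QS = Summation (Poset.Eq.setoid Q.poset)
    open Membership Eq.setoid using (_∈_)
    open Membership (Poset.Eq.setoid Q.poset) using () renaming (_∈_ to _∈ᵠ_)

    injective-above : ∀ {v w} → z <ᴾ v → z <ᴾ w → ι v ≡ ι w → v ≈ w
    injective-above {v} {w} z<v z<w eq = decidable-stable (v ≈? w) λ v≉w →
      [ (λ v<w → ℤ.<⇒≢ (preserves (above z<v) (inj₁ κv≡κw) v<w) eq)
      , (λ w≤v → ℤ.<⇒≢ (preserves (above z<w) (inj₁ (sym κv≡κw)) (w≤v , v≉w ∘ Eq.sym)) (sym eq))
      ]′ (linked-compare (inj₁ κv≡κw))
      where
      κv≡κw : κ v ≡ κ w
      κv≡κw = trans (sym (ι-color v)) (trans (cong letter eq) (ι-color w))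

    images : List Carrier → List Q.Carrier
    images = map (lift ∘ ι)

    ∈-images⁻ : ∀ {q xs} → q ∈ᵠ images xs → ∃[ v ] v ∈ xs × lower q ≡ ι v
    ∈-images⁻ q∈ =
      let v , v∈ , lift eq = Membershipₚ.∈-map⁻ Eq.setoid (Poset.Eq.setoid Q.poset) q∈ in v , v∈ , eq

    images-unique : ∀ {xs} → (∀ {v} → v ∈ xs → z <ᴾ v) → UniqueSetoid.Unique Eq.setoid xs →
                    UniqueSetoid.Unique (Poset.Eq.setoid Q.poset) (images xs)
    images-unique {[]}     above-z xs! = []
    images-unique {x ∷ xs} above-z xs! = QS.unique-∷
      (λ x∈ → let v , v∈ , eq = ∈-images⁻ {xs = xs} x∈ in PS.unique-head xs!
        (Membershipₚ.∈-resp-≈ Eq.setoid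
          (Eq.sym (injective-above (above-z (here Eq.refl)) (above-z (there v∈)) eq)) v∈))
      (images-unique (above-z ∘ there) (PS.unique-tail xs!))

    images-sum : ∀ xs → QS.sum (QH.weight a) (images xs) ≡ PS.sum (weight a) xs
    images-sum []       = refl
    images-sum (x ∷ xs) = cong₂ ℤ._+_ (cong (λ b → ℤ.- θ b a) (ι-color x)) (images-sum xs)

    -- The elements of (z, z⁺) adjacent to a embed into (ι z, ι z⁺), and both
    -- intervals have total weight 2, so no adjacent position is missed.
    covered : ∀ {q} → a ∼ letter q → ι z ℤ.< q → q ℤ.< ι z⁺ → ∃[ v ] ι v ≡ q × z <ᴾ v
    covered {q} a∼q ιz<q q<ιz⁺ =
      let xs , (xs! , xs↔) , total  = ice con
          qs , (qs! , qs↔) , totalᵠ = iceᵠ conᵠ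
          q∈ = decidable-stable (any? (lift q QH.≈?_) (images xs)) λ q∉ →
            let larger = QS.sum-mono {f = QH.weight a} QH.weight-cong {lift q ∷ images xs} {qs}
                  (λ {w} w∈ → nonnegative (Equivalence.to (qs↔ w) w∈))
                  (QS.unique-∷ q∉ (images-unique (λ {v} v∈ → proj₁ (Equivalence.to (xs↔ v) v∈)) xs!))
                  (λ {w} w≢0 → λ
                    { (here (lift w≡q)) → Equivalence.from (qs↔ w) (between w≡q a∼q ιz<q q<ιz⁺)
                    ; (there w∈) →
                        let v , v∈ , w≡ιv = ∈-images⁻ {xs = xs} w∈
                            z<v , v<z⁺ = Equivalence.to (xs↔ v) v∈
                            κv∼a = θ≢0⇒∼ (proj₂ (proj₂ (proj₂ con)) v (z<v , v<z⁺))
                                     (-θ≢0⇒θ≢0 (subst (λ b → ℤ.- θ b a ≢ 0ℤ)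
                                       (trans (cong letter w≡ιv) (ι-color v)) w≢0))
                            i< , <j = inside (Linked-sym (inj₂ κv∼a)) z<v v<z⁺
                        in Equivalence.from (qs↔ w)
                             (between w≡ιv (subst (a ∼_) (sym (ι-color v)) (∼-sym κv∼a)) i< <j) })
                weight-q = subst (1ℤ ℤ.≤_) (sym (-θ≡wt (proj₁ (∼-sym a∼q)))) (+≤+ (∼⇒wt>0 (∼-sym a∼q)))
            in contradiction (ℤ.≤-trans
                 (ℤ.+-mono-≤ weight-q (ℤ.≤-reflexive (sym (trans (images-sum xs) total))))
                 (subst (QS.sum (QH.weight a) (lift q ∷ images xs) ℤ.≤_) totalᵠ larger))
                 λ { (+≤+ (s≤s (s≤s ()))) }
          v , v∈ , q≡ιv = ∈-images⁻ {xs = xs} q∈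
      in v , sym q≡ιv , proj₁ (Equivalence.to (xs↔ v) v∈)
      where
      nonnegative : ∀ {w} → Q.⦅ lift (ι z) , lift (ι z⁺) ⦆ w → 0ℤ ℤ.≤ QH.weight a w
      nonnegative {w} w∈ = subst (0ℤ ℤ.≤_) (sym (-θ≡wt (proj₂ (proj₂ (proj₂ conᵠ)) w w∈))) (+≤+ z≤n)
      between : ∀ {w i} → lower w ≡ i → a ∼ letter i → ι z ℤ.< i → i ℤ.< ι z⁺ →
                Q.⦅ lift (ι z) , lift (ι z⁺) ⦆ w
      between refl a∼i z<i i<z⁺ =
        linked⇒< z<i (inj₂ (subst (_∼ _) (sym (ι-color z)) a∼i)) ,
        linked⇒< i<z⁺ (Linked-sym (inj₂ (subst (_∼ _) (sym (trans (ι-color z⁺) κz⁺≡a)) a∼i)))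

    lifts-z : ∀ {q} → Linked a (letter q) → ι z ℤ.< q → ∃[ v ] ι v ≡ q × z <ᴾ v
    lifts-z {q} l ιz<q with ℤ.<-cmp q (ι z⁺)
    ... | tri≈ _ q≡ _ = z⁺ , sym q≡ , z<z⁺
    ... | tri> _ _ z⁺<q = let v , eq , z⁺<v = lifts (above z<z⁺) (linked⁺ l) z⁺<q in v , eq , <-trans z<z⁺ z⁺<v
    ... | tri< q<z⁺ _ _ with l
    ...   | inj₂ a∼q = covered a∼q ιz<q q<z⁺
    ...   | inj₁ a≡q = contradiction (sym a≡q) (proj₂ (proj₂ (proj₂ conᵠ)) (lift q)
              ( linked⇒< ιz<q (inj₁ (trans (ι-color z) a≡q))
              , linked⇒< q<z⁺ (inj₁ (trans (sym a≡q) (trans (sym κz⁺≡a) (sym (ι-color z⁺)))))))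

  faithful : ∀ z → Faithful z
  faithful z = go z (climb top z)
    where
    go : ∀ z → Acc (Climb top) z → Faithful z
    go z (acc rs) with High? z
    ... | yes hz = high-faithful hz
    ... | no ¬hz = record { preserves = preserves-z ; lifts = lifts-z }
      where
      above : ∀ {v} → z <ᴾ v → Faithful v
      above {v} z<v with High? v
      ... | yes hv = high-faithful hv
      ... | no ¬hv = go v (rs (z<v , low≤top ¬hv))
      open Step ¬hz (proj₂ (successor z)) above

  ι-injective : ∀ {x y} → ι x ≡ ι y → x ≈ y
  ι-injective {x} {y} eq = decidable-stable (x ≈? y) λ x≉y →
    [ (λ x<y → ℤ.<⇒≢ (preserves (faithful x) (inj₁ κx≡κy) x<y) eq)
    , (λ y≤x → ℤ.<⇒≢ (preserves (faithful y) (inj₁ (sym κx≡κy)) (y≤x , x≉y ∘ Eq.sym)) (sym eq))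
    ]′ (linked-compare (inj₁ κx≡κy))
    where
    κx≡κy : κ x ≡ κ y
    κx≡κy = trans (sym (ι-color x)) (trans (cong letter eq) (ι-color y))

  ι-mono : ∀ {x y} → x ≤ᴾ y → Path (ι x) (ι y)
  ι-mono {x} {y} = go (climb y x)
    where
    go : ∀ {x} → Acc (Climb y) x → x ≤ᴾ y → Path (ι x) (ι y)
    go {x} (acc rs) x≤y with x ≈? y
    ... | yes x≈y = subst (Path (ι x)) (ι-cong x≈y) ε
    ... | no  x≉y =
      let z , x⋖z , z≤y = cover-above (x≤y , x≉y)
          l = inj₂ (neighbors-adjacent x z (inj₁ x⋖z))
      in (preserves (faithful x) l (proj₁ x⋖z) , subst₂ Linked (sym (ι-color x)) (sym (ι-color z)) l)
         ◅ go (rs (proj₁ x⋖z , z≤y)) z≤y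

  -- Paths are lifted edge by edge. Keeping `x ≤ᴾ y` in the conclusion yields, with injectivity,
  -- that the order is reflected.
  ι-upClosed : ∀ x {q} → Path (ι x) q → ∃[ y ] ι y ≡ q × x ≤ᴾ y
  ι-upClosed x p = go x refl p
    where
    go : ∀ x {i q} → i ≡ ι x → Path i q → ∃[ y ] ι y ≡ q × x ≤ᴾ y
    go x i≡ ε = x , sym i≡ , ≤-refl
    go x refl (_◅_ {j = j} (ιx<j , l) path) =
      let v , ιv≡j , x<v = lifts (faithful x) (subst (λ b → Linked b _) (ι-color x) l) ιx<j
          y , ιy≡q , v≤y = go v (sym ιv≡j) path
      in y , ιy≡q , ≤-trans (proj₁ x<v) v≤y

  isFilterOf : IsFilterOf P heap
  isFilterOf = record
    { ι        = lift ∘ ι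
    ; ι-mono   = record
      { isOrderHomomorphism = record { cong = λ x≈y → lift (ι-cong x≈y) ; mono = λ x≤y → lift (ι-mono x≤y) }
      ; injective = λ (lift eq) → ι-injective eq
      ; cancel    = λ {x} (lift path) →
          let v , ιv≡ , x≤v = ι-upClosed x path in ≤-trans x≤v (≤-reflexive (ι-injective ιv≡))
      }
    ; ι-color  = ι-color
    ; upClosed = λ x q (lift path) → let y , eq , _ = ι-upClosed x path in y , lift eq
    }

-- Filters of full heaps

module FullHeap {c ℓ₁ ℓ₂ : Level} (em : ExcludedMiddle (c ⊔ ℓ₁ ⊔ ℓ₂)) {Γ : DynkinDiagram}
                (Q : ColoredPoset Γ c ℓ₁ ℓ₂) (fullHeap : IsFullHeap Q) where
  open DynkinDiagram Γ
  open Weights Γ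
  open ColoredPoset Q
  open Poset poset using (module Eq; antisym)
    renaming (refl to ≤-refl; trans to ≤-trans; reflexive to ≤-reflexive)
  open PosetProperties poset using (<-trans; <-irrefl; <-respˡ-≈; <-respʳ-≈)
  open Membership Eq.setoid using (_∈_; _∉_)
  open Summation Eq.setoid
  open IsFullHeap fullHeap

  κ-cong : ∀ {x y} → x ≈ y → κ x ≡ κ y
  κ-cong = Surjection.cong coloring

  ice : ∀ {a x y} → Consecutive a x y → HasSum ⦅ x , y ⦆ (λ z → ℤ.- θ (κ z) a) (+ 2)
  ice {a} {x} {y} con@(x<y , κx≡a , κy≡a , _) =
    let xs , (xs! , e) , total = G5 a x y con
        r₁ = remove (Equivalence.from (e x) (≤-refl , proj₁ x<y))
        y∈ = [ (λ y≈x → contradiction x<y (<-irrefl (Eq.sym y≈x))) , id ]′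
               (Removal.cover r₁ (Equivalence.from (e y) (proj₁ x<y , ≤-refl)))
        r₂ = remove y∈
        module R₁ = Removal r₁
        module R₂ = Removal r₂
        open-sum = trans (sym (R₁.total f-cong)) total
    in R₂.rest , (R₂.unique (R₁.unique xs!) , λ z → mk⇔
         (λ z∈ → let x≤z , z≤y = Equivalence.to (e z) (R₁.sub (R₂.sub z∈))
                 in (x≤z , λ x≈z → R₁.fresh xs! (Membershipₚ.∈-resp-≈ Eq.setoid (Eq.sym x≈z) (R₂.sub z∈)))
                  , (z≤y , λ z≈y → R₂.fresh (R₁.unique xs!) (Membershipₚ.∈-resp-≈ Eq.setoid z≈y z∈)))
         (λ ((x≤z , x≉z) , (z≤y , z≉y)) →
            [ (λ z≈x → contradiction (Eq.sym z≈x) x≉z)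
            , (λ z∈₁ → [ (λ z≈y → contradiction z≈y z≉y) , id ]′ (R₂.cover z∈₁))
            ]′ (R₁.cover (Equivalence.from (e z) (x≤z , z≤y))))) ,
       trans (negate R₂.rest) (cong ℤ.-_ (solve (sum f R₂.rest)
         (trans (cong₂ (λ i j → i ℤ.+ (j ℤ.+ sum f R₂.rest)) (sym (f≡2 κx≡a)) (sym (f≡2 κy≡a)))
           (trans (cong (λ i → f x ℤ.+ i) (sym (R₂.total f-cong))) open-sum))))
    where
    f : Carrier → ℤ
    f z = θ (κ z) a
    f-cong : Congruent f
    f-cong x≈y = cong (λ b → θ b a) (κ-cong x≈y)
    f≡2 : ∀ {z} → κ z ≡ a → f z ≡ + 2
    f≡2 κz≡a = trans (cong (λ b → θ b a) κz≡a) (θ-diag a)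
    negate : ∀ zs → sum (λ z → ℤ.- f z) zs ≡ ℤ.- sum f zs
    negate []       = refl
    negate (z ∷ zs) = trans (cong (λ i → ℤ.- f z ℤ.+ i) (negate zs)) (sym (ℤ.neg-distrib-+ (f z) (sum f zs)))
    solve : ∀ i → + 2 ℤ.+ (+ 2 ℤ.+ i) ≡ + 2 → i ≡ ℤ.- (+ 2)
    solve i eq = begin
      i                                        ≡⟨ ℤ.+-identityˡ i ⟨
      ℤ.- (+ 4) ℤ.+ + 4 ℤ.+ i                  ≡⟨ ℤ.+-assoc (ℤ.- (+ 4)) (+ 4) i ⟩
      ℤ.- (+ 4) ℤ.+ (+ 4 ℤ.+ i)                ≡⟨ cong (λ j → ℤ.- (+ 4) ℤ.+ j) (ℤ.+-assoc (+ 2) (+ 2) i) ⟩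
      ℤ.- (+ 4) ℤ.+ (+ 2 ℤ.+ (+ 2 ℤ.+ i))      ≡⟨ cong (λ j → ℤ.- (+ 4) ℤ.+ j) eq ⟩
      ℤ.- (+ 2)                                ∎
      where open ≡-Reasoning

  -- Otherwise dropping the pair (x , y) would leave a smaller partial order
  -- extending the orders of the chains.
  cover-adjacent : ∀ {x y} → x ⋖ y → κ x ∼ κ y
  cover-adjacent {x} {y} (x<y , none) with κ x Fin.≟ κ y
  ... | yes κx≡κy = contradiction
    (let xs , (_ , e) , total = ice (x<y , refl , sym κx≡κy , λ z z∈ _ → none (z , z∈))
     in empty-sum xs (λ z z∈ → none (z , Equivalence.to (e z) z∈)) total) id
    where
    empty-sum : ∀ {f} xs → (∀ z → z ∉ xs) → ¬ sum f xs ≡ + 2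
    empty-sum []       _     ()
    empty-sum (z ∷ zs) empty _ = empty z (here Eq.refl)
  ... | no κx≢κy = decidable-stable (map′ lower lift (em {Lift (c ⊔ ℓ₁ ⊔ ℓ₂) (κ x ∼ κ y)})) λ ¬adj →
    proj₂ (lower (G2 _≼_ isPartialOrder
      (λ a {u} {v} κu≡a κv≡a u≤v → lift (u≤v , λ (u≈x , v≈y) →
        κx≢κy (trans (sym (κ-cong u≈x)) (trans κu≡a (trans (sym κv≡a) (κ-cong v≈y))))))
      (λ b d b∼d {u} {v} u∈ v∈ u≤v → lift (u≤v , λ (u≈x , v≈y) →
        ¬adj (adjacent b∼d (Sum.map (trans (sym (κ-cong u≈x))) (trans (sym (κ-cong u≈x))) u∈)
                           (Sum.map (trans (sym (κ-cong v≈y))) (trans (sym (κ-cong v≈y))) v∈))))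
      x y (proj₁ x<y))) (Eq.refl , Eq.refl)
    where
    adjacent : ∀ {b d} → b ∼ d → κ x ≡ b ⊎ κ x ≡ d → κ y ≡ b ⊎ κ y ≡ d → κ x ∼ κ y
    adjacent b∼d (inj₁ eq) (inj₁ eq′) = contradiction (trans eq (sym eq′)) κx≢κy
    adjacent b∼d (inj₁ eq) (inj₂ eq′) = subst₂ _∼_ (sym eq) (sym eq′) b∼d
    adjacent b∼d (inj₂ eq) (inj₁ eq′) = subst₂ _∼_ (sym eq) (sym eq′) (∼-sym b∼d)
    adjacent b∼d (inj₂ eq) (inj₂ eq′) = contradiction (trans eq (sym eq′)) κx≢κy
    _≼_ : Rel Carrier (c ⊔ ℓ₁ ⊔ ℓ₂)
    u ≼ v = Lift (c ⊔ ℓ₁ ⊔ ℓ₂) (u ≤ᴾ v × ¬ (u ≈ x × v ≈ y))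
    x≉y : ¬ x ≈ y
    x≉y = proj₂ x<y
    -- A composition giving the dropped pair would use that pair itself or pass strictly between `x`
    -- and `y`, which the cover forbids.
    ≼-trans : ∀ {u v w} → u ≼ v → v ≼ w → u ≼ w
    ≼-trans {u} {v} {w} (lift (u≤v , ¬uv)) (lift (v≤w , ¬vw)) = lift (≤-trans u≤v v≤w , λ (u≈x , w≈y) →
      none (v , (≤-trans (≤-reflexive (Eq.sym u≈x)) u≤v , λ x≈v → ¬vw (Eq.sym x≈v , w≈y))
              , (≤-trans v≤w (≤-reflexive w≈y) , λ v≈y → ¬uv (u≈x , v≈y))))
    isPartialOrder : IsPartialOrder _≈_ _≼_
    isPartialOrder = record
      { isPreorder = record
        { isEquivalence = Eq.isEquivalence
        ; reflexive     = λ u≈v → lift (≤-reflexive u≈v , λ (u≈x , v≈y) →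
            x≉y (Eq.trans (Eq.sym u≈x) (Eq.trans u≈v v≈y)))
        ; trans         = ≼-trans
        }
      ; antisym = λ (lift (u≤v , _)) (lift (v≤u , _)) → antisym u≤v v≤u
      }

  neighbors-adjacent : ∀ {x y} → Neighbors x y → κ x ∼ κ y
  neighbors-adjacent (inj₁ x⋖y) = cover-adjacent x⋖y
  neighbors-adjacent (inj₂ y⋖x) = ∼-sym (cover-adjacent y⋖x)

  higher : ∀ x → ∃[ y ] κ y ≡ κ x × x <ᴾ y
  higher x =
    let f , iso = G3 (κ x)
        module Iso = IsOrderIsomorphism iso
        (y , κy≡) , f≡ = Iso.surjective (ℤ.suc (f (x , refl)))
        fy≡ = f≡ Eq.refl
    in y , κy≡ , Iso.cancel (subst (f (x , refl) ℤ.≤_) (sym fy≡) (ℤ.<⇒≤ (i<suc _)))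
               , λ x≈y → ℤ.<⇒≢ (i<suc (f (x , refl))) (trans (Iso.cong {x , refl} {y , κy≡} x≈y) fy≡)

module Filter {c ℓ₁ ℓ₂ : Level} (em : ExcludedMiddle (c ⊔ ℓ₁ ⊔ ℓ₂)) {Γ : DynkinDiagram}
              (P Q : ColoredPoset Γ c ℓ₁ ℓ₂) (fullHeap : IsFullHeap Q) (filter : IsFilterOf P Q) where
  open DynkinDiagram Γ
  open Weights Γ
  open IsFilterOf filter
  open IsFullHeap fullHeap
  open IsOrderMonomorphism ι-mono using (mono; cancel; injective) renaming (cong to ι-cong)
  private
    module P = ColoredPoset P
    module Q = ColoredPoset Q
    module HQ = FullHeap em Q fullHeap
    module P≤ = Poset P.poset
    module Q≤ = Poset Q.poset
    module P< = PosetProperties P.poset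
    module Q< = PosetProperties Q.poset

  _≤?_ : Decidable P._≤ᴾ_
  x ≤? y = map′ lower lift (em {Lift (c ⊔ ℓ₁ ⊔ ℓ₂) (x P.≤ᴾ y)})

  open FinitePoset P.poset _≤?_ using (_<?_; enumerate)

  ι-< : ∀ {x y} → x P.<ᴾ y → ι x Q.<ᴾ ι y
  ι-< (x≤y , x≉y) = mono x≤y , x≉y ∘ injective

  ι-<⁻ : ∀ {x y} → ι x Q.<ᴾ ι y → x P.<ᴾ y
  ι-<⁻ (x≤y , x≉y) = cancel x≤y , x≉y ∘ ι-cong

  -- Everything above `ι x` is in the image of the filter, so an interval of `Q` between image
  -- points contains no new elements.
  interval-lift : ∀ {x y q} → Q.⦅ ι x , ι y ⦆ q → ∃[ z ] ι z Q.≈ q × P.⦅ x , y ⦆ z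
  interval-lift {x} {y} {q} (x<q , q<y) =
    let z , ιz≈q = upClosed x q (proj₁ x<q)
    in z , ιz≈q , ι-<⁻ (Q<.<-respʳ-≈ (Q≤.Eq.sym ιz≈q) x<q) , ι-<⁻ (Q<.<-respˡ-≈ (Q≤.Eq.sym ιz≈q) q<y)

  color-lift : ∀ {z q} → ι z Q.≈ q → P.κ z ≡ Q.κ q
  color-lift ιz≈q = trans (sym (ι-color _)) (HQ.κ-cong ιz≈q)

  comparable : ∀ {x y} → Q.Comparable (ι x) (ι y) → P.Comparable x y
  comparable = Sum.map cancel cancel

  ι-⋖ : ∀ {x y} → x P.⋖ y → ι x Q.⋖ ι y
  ι-⋖ (x<y , none) = ι-< x<y , λ (q , q∈) → let z , _ , z∈ = interval-lift q∈ in none (z , z∈)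

  ι-consecutive : ∀ {a x y} → P.Consecutive a x y → Q.Consecutive a (ι x) (ι y)
  ι-consecutive (x<y , κx≡a , κy≡a , gap) =
    ι-< x<y , trans (ι-color _) κx≡a , trans (ι-color _) κy≡a , λ q q∈ κq≡a →
      let z , ιz≈q , z∈ = interval-lift q∈ in gap z z∈ (trans (color-lift ιz≈q) κq≡a)

  ice : ∀ a x y → P.Consecutive a x y → P.HasSum P.⦅ x , y ⦆ (λ z → ℤ.- θ (P.κ z) a) (+ 2)
  ice a x y con =
    let qs , (qs! , qs↔) , total = HQ.ice (ι-consecutive con)
        xs , xs! , xs↔ = enumerate {R = P.⦅ x , y ⦆} (λ z → (x <? z) ×-dec (z <? y))
          (λ v≈w (x<v , v<y) → P<.<-respʳ-≈ v≈w x<v , P<.<-respˡ-≈ v≈w v<y)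
          (proj₁ (P.locallyFinite x y))
          (λ z (x<z , z<y) → Equivalence.from (proj₂ (proj₂ (P.locallyFinite x y)) z) (proj₁ x<z , proj₁ z<y))
    in xs , (xs! , xs↔) , trans (sym (sum-ι xs)) (trans
         (QS.sum-agree (λ v≈w → cong (λ b → ℤ.- θ b a) (HQ.κ-cong v≈w))
           (Uniqueₚ.map⁺ P≤.Eq.setoid Q≤.Eq.setoid injective xs!) qs!
           (λ {q} _ q∈ → let z , z∈ , q≈ιz = Membershipₚ.∈-map⁻ P≤.Eq.setoid Q≤.Eq.setoid q∈
                             x<z , z<y = Equivalence.to (xs↔ z) z∈
                         in Equivalence.from (qs↔ q) ( Q<.<-respʳ-≈ (Q≤.Eq.sym q≈ιz) (ι-< x<z)
                                                     , Q<.<-respˡ-≈ (Q≤.Eq.sym q≈ιz) (ι-< z<y)))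
           (λ {q} _ q∈ → let z , ιz≈q , z∈ = interval-lift (Equivalence.to (qs↔ q) q∈)
                         in Membershipₚ.∈-resp-≈ Q≤.Eq.setoid ιz≈q
                              (Membershipₚ.∈-map⁺ P≤.Eq.setoid Q≤.Eq.setoid ι-cong (Equivalence.from (xs↔ z) z∈))))
         total)
    where
    module QS = Summation Q≤.Eq.setoid
    module PS = Summation P≤.Eq.setoid
    sum-ι : ∀ xs → QS.sum (λ q → ℤ.- θ (Q.κ q) a) (map ι xs) ≡ PS.sum (λ z → ℤ.- θ (P.κ z) a) xs
    sum-ι []       = refl
    sum-ι (z ∷ zs) = cong₂ ℤ._+_ (cong (λ b → ℤ.- θ b a) (ι-color z)) (sum-ι zs)

  -- By G3 every color of `Q` continues upwards without end, and the filter inherits this. Hence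
  -- UCB1 holds vacuously.
  not-maximal : ∀ {a x} → ¬ P.MaximalOfColor a x
  not-maximal {a} {x} (κx≡a , max) =
    let q , κq≡ , x<q = HQ.higher (ι x)
        y , ιy≈q = upClosed x q (proj₁ x<q)
    in max y (trans (color-lift ιy≈q) (trans κq≡ (trans (ι-color x) κx≡a)))
             (ι-<⁻ (Q<.<-respʳ-≈ (Q≤.Eq.sym ιy≈q) x<q))

  isDComplete : IsDComplete P
  isDComplete = record
    { EC   = λ x y κx≡κy → comparable (G1-color (P.κ x) (ι-color x) (trans (ι-color y) (sym κx≡κy)))
    ; NA   = λ x y x-y → subst₂ _∼_ (ι-color x) (ι-color y) (HQ.neighbors-adjacent (Sum.map ι-⋖ ι-⋖ x-y))
    ; AC   = λ x y κx∼κy → comparable (G1-adjacent (P.κ x) (P.κ y) κx∼κy (inj₁ (ι-color x)) (inj₂ (ι-color y)))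
    ; ICE2 = ice
    ; UCB1 = λ a x max → contradiction max not-maximal
    }

-- The full heap containing a d-complete poset

module HeapExtension {c ℓ₁ ℓ₂ : Level} (em : ExcludedMiddle (c ⊔ ℓ₁ ⊔ ℓ₂))
  {Γ : DynkinDiagram} (P : ColoredPoset Γ c ℓ₁ ℓ₂) (dComplete : IsDComplete P)
  (connected : ColoredPoset.Connected P) (infinite : ColoredPoset.Infinite P) where
  open DynkinDiagram Γ
  open Firing Γ
  open ColoredPoset P
  open Poset poset using (module Eq) renaming (trans to ≤-trans; reflexive to ≤-reflexive)
  open DComplete em P dComplete connected infinite
  open IsDComplete dComplete

  fromWord : ∀ s (w : BiInfiniteWord) → (∀ k → BiInfiniteWord.letter w (+ k) ≡ word (s ℕ.+ k)) →
             Σ (ColoredPoset Γ c ℓ₁ ℓ₂) λ Q → IsFullHeap Q × ColoredPoset.Connected Q × IsFilterOf P Q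
  fromWord s w agrees = heap , heap-isFullHeap , heap-connected colorConnected , isFilterOf
    where
    open WordHeap lem Γ w c ℓ₁ ℓ₂ using (heap; heap-isFullHeap; heap-connected)

    h : ℕ → Carrier
    h k = p (s ℕ.+ k)

    High : Carrier → Set ℓ₁
    High x = ∃[ k ] h k ≈ x

    later-high : ∀ {j x} → s ℕ.≤ j → p j ≈ x → High x
    later-high {j} {x} s≤j pj≈x = j ℕ.∸ s , subst (λ l → p l ≈ x) (sym (ℕ.m+[n∸m]≡n s≤j)) pj≈x

    high-up : ∀ {x y} → x ≤ᴾ y → High x → High y
    high-up {x} {y} x≤y (k , hk≈x) =
      let j , y≈pj = exhausts (λ y≤t → outside (s ℕ.+ k) (≤-trans (≤-reflexive hk≈x) (≤-trans x≤y y≤t)))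
      in later-high (climb-index y≈pj) (Eq.sym y≈pj)
      where
      climb-index : ∀ {j} → y ≈ p j → s ℕ.≤ j
      climb-index {j} y≈pj = ℕ.≮⇒≥ λ j<s → contradiction
        (<⇒index< ( ≤-trans (≤-reflexive hk≈x) (≤-trans x≤y (≤-reflexive y≈pj))
                  , distinct (ℕ.<-≤-trans j<s (ℕ.m≤m+n s k))))
        (ℕ.<-asym (ℕ.<-≤-trans j<s (ℕ.m≤m+n s k)))

    -- The elements that are not high are those below `t₀` and the first `s` listed ones. A common
    -- bound for them is what lets the embedding proceed by induction from the top down.
    roof : ∃[ T ] t₀ ≤ᴾ T × (∀ i → p (toℕ {s} i) ≤ᴾ T)
    roof = upper t₀ (p ∘ toℕ)

    low≤roof : ∀ {x} → ¬ High x → x ≤ᴾ proj₁ roof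
    low≤roof {x} ¬hx with x ≤? t₀
    ... | yes x≤t = ≤-trans x≤t (proj₁ (proj₂ roof))
    ... | no  x≰t =
      let j , x≈pj = exhausts x≰t
          j<s = ℕ.≰⇒> λ s≤j → ¬hx (later-high s≤j (Eq.sym x≈pj))
      in ≤-trans (≤-reflexive x≈pj)
           (subst (λ l → p l ≤ᴾ proj₁ roof) (Fin.toℕ-fromℕ< j<s) (proj₂ (proj₂ roof) (fromℕ< j<s)))

    listing : UpperListing P (BiInfiniteWord.letter w)
    listing = record
      { h            = h
      ; h-letter     = agrees
      ; h-reflects-< = λ hi<hj → ℕ.+-cancelˡ-< s _ _ (<⇒index< hi<hj)
      ; h-increasing = λ i<j → index<⇒< (ℕ.+-monoʳ-< s i<j)
      ; h-injective  = λ hi≈hj → ℕ.+-cancelˡ-≡ s _ _ (index-unique hi≈hj)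
      ; High?        = λ x → map′ lower lift (em {Lift (c ⊔ ℓ₁ ⊔ ℓ₂) (High x)})
      ; high-up      = high-up
      ; top          = proj₁ roof
      ; low≤top      = low≤roof
      }

    open Embedding P _≤?_ heapLike NA higher lem w listing using (isFilterOf)

  extends : Σ (ColoredPoset Γ c ℓ₁ ℓ₂) λ Q → IsFullHeap Q × ColoredPoset.Connected Q × IsFilterOf P Q
  extends = let s , w , agrees = WordLimits.extension lem Γ heaped recurrent in fromWord s w agrees

theorem5p7 : ∀ {c ℓ₁ ℓ₂ : Level} → ExcludedMiddle (c ⊔ ℓ₁ ⊔ ℓ₂) →
    (Γ : DynkinDiagram) (P : ColoredPoset Γ c ℓ₁ ℓ₂) →
    ColoredPoset.Connected P → ColoredPoset.Infinite P →
    IsDComplete P ⇔ (Σ (ColoredPoset Γ c ℓ₁ ℓ₂) λ Q →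
    IsFullHeap Q × ColoredPoset.Connected Q × IsFilterOf P Q)
theorem5p7 em Γ P connected infinite = mk⇔
  (λ dComplete → HeapExtension.extends em P dComplete connected infinite)
  (λ (Q , fullHeap , _ , filter) → Filter.isDComplete em P Q fullHeap filter)
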